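{- Let $n\ge 6$ be an even integer, let $c$ be an integer with $1<c<n/2$, let $S=\{\pm 1,\pm c,n/2\}\subseteq\mathbb{Z}_n$, and assume that $\Gamma=\mathrm{Cay}(\mathbb{Z}_n;S)$ is closed distance magic. Assume that there exists $j\in\mathcal{J}_n(S)$ which is of type $2$. Then the only elements of $\mathcal{J}_n(S)$ which are of type $2$ are $n/3$ and $2n/3$. In particular, $c$ is not divisible by $3$.
   Context: $\mathrm{Cay}(\mathbb{Z}_n;S)$ is the graph with vertex set $\mathbb{Z}_n$ in which $g,h$ are adjacent iff $h-g\in S$. A graph $\Gamma=(V,E)$ of order $n$ is closed distance magic if there are a bijection $\ell:V\to\{1,\ldots,n\}$ and a positive integer $r$ such that for all $u\in V$ the sum of the labels of $u$ and all its neighbors equals $r$. For $0\le j\le n-1$ let $\chi_j(x)=\cos(2\pi xj/n)+\mathbf{i}\sin(2\pi xj/n)$ and $\chi_j(S)=\sum_{x\in S}\chi_j(x)$; $\mathcal{J}_n(S)$ is the set of $j\in\{0,\ldots,n-1\}$ with $\chi_j(S)=-1$. An even $j\in\mathcal{J}_n(S)$ is of type $2$ if $\{\frac{2\pi j}{n},\frac{2\pi jc}{n}\}=\{\pm\frac{2\pi}{3}+2k_1\pi,\pm\frac{2\pi}{3}+2k_2\pi\}$ for some $k_1,k_2\in\mathbb{Z}$ and some (independent) choice of signs. -}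

module Defs where

open import Data.Nat.Base as ℕ using (ℕ; zero; suc)
import Data.Nat.Properties as ℕₚ
open import Data.Nat.Divisibility using (_∣_)
open import Data.Nat.DivMod using () renaming (_/_ to _/ℕ_)
open import Data.Nat.ListAction using (sum)
open import Data.Integer.Base as ℤ using (ℤ; +_; -[1+_])
import Data.Integer.Properties as ℤₚ
open import Data.Integer.DivMod using (_%ℕ_; n%ℕd<d)
open import Data.Sign.Base using (Sign)
open import Data.Rational.Base
open import Data.Rational.Properties
import Data.Rational.Unnormalised.Base as ᵘ
import Data.Rational.Unnormalised.Properties as ᵘₚ
open import Data.Rational.Solver using (module +-*-Solver)
open import Data.Fin.Base using (Fin; toℕ; fromℕ<)
open import Data.Fin.Subset using (Subset; ⁅_⁆; _∪_; _∈_)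
open import Data.Fin.Subset.Properties using (_∈?_)
open import Data.List.Base using (foldr; map; filter; allFin)
open import Data.Product.Base using (∃-syntax; _×_; _,_; proj₁; proj₂)
open import Data.Sum.Base using (_⊎_; inj₁; inj₂)
open import Function.Bundles using (_⤖_; module Bijection)
open import Level using (0ℓ)
open import Relation.Binary.Core using (Rel)
open import Relation.Binary.Definitions using (Decidable)
open import Relation.Binary.PropositionalEquality using (_≡_; refl; sym; trans; cong; cong₂; subst; subst₂)
open import Relation.Nullary.Negation.Core using (¬_)
open import Relation.Unary using (Pred; _≐_)

0≤ι/ : ∀ m d .{{_ : ℕ.NonZero d}} → 0ℚ ≤ + m / d
0≤ι/ m d = nonNegative⁻¹ _ {{normalize-nonNeg m d}}

*-mono-≤₀ : ∀ {a b c d} → 0ℚ ≤ a → a ≤ b → 0ℚ ≤ c → c ≤ d → a * c ≤ b * d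
*-mono-≤₀ {a} {b} {c} {d} 0≤a a≤b 0≤c c≤d = ≤-trans
  (*-monoʳ-≤-nonNeg c {{nonNegative 0≤c}} a≤b)
  (*-monoˡ-≤-nonNeg b {{nonNegative (≤-trans 0≤a a≤b)}} c≤d)

0≤* : ∀ {a b} → 0ℚ ≤ a → 0ℚ ≤ b → 0ℚ ≤ a * b
0≤* {a} {b} 0≤a 0≤b = subst (_≤ a * b) (*-zeroˡ b) (*-monoʳ-≤-nonNeg b {{nonNegative 0≤b}} 0≤a)

0≤+ : ∀ {a b} → 0ℚ ≤ a → 0ℚ ≤ b → 0ℚ ≤ a + b
0≤+ 0≤a 0≤b = +-mono-≤ 0≤a 0≤b

∣+∣≤ : ∀ {p q a b} → ∣ p ∣ ≤ a → ∣ q ∣ ≤ b → ∣ p + q ∣ ≤ a + b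
∣+∣≤ {p} {q} x y = ≤-trans (∣p+q∣≤∣p∣+∣q∣ p q) (+-mono-≤ x y)

∣*∣≤ : ∀ {p q a b} → ∣ p ∣ ≤ a → ∣ q ∣ ≤ b → ∣ p * q ∣ ≤ a * b
∣*∣≤ {p} {q} {a} {b} x y = subst (_≤ a * b) (sym (∣p*q∣≡∣p∣*∣q∣ p q))
  (*-mono-≤₀ (0≤∣p∣ p) x (0≤∣p∣ q) y)

∣-∣-comm : ∀ p q → ∣ p - q ∣ ≡ ∣ q - p ∣
∣-∣-comm p q = trans (sym (∣-p∣≡∣p∣ (p - q)))
  (cong ∣_∣ (solve 2 (λ p q → :- (p :- q) := q :- p) refl p q))
  where open +-*-Solver

0<½* : ∀ {ε} → 0ℚ < ε → 0ℚ < ½ * ε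
0<½* {ε} 0<ε = subst (_< ½ * ε) (*-zeroʳ ½) (*-monoʳ-<-pos ½ 0<ε)

½+½ : ∀ ε → ½ * ε + ½ * ε ≡ ε
½+½ = solve 1 (λ e → con ½ :* e :+ con ½ :* e := e) refl
  where open +-*-Solver

p≤p+q : ∀ {p q} → 0ℚ ≤ q → p ≤ p + q
p≤p+q {p} {q} 0≤q = subst (_≤ p + q) (+-identityʳ p) (+-monoʳ-≤ p 0≤q)

shrink : ∀ {B ε} → 0ℚ ≤ B → 0ℚ < ε → ∃[ δ ] 0ℚ < δ × B * δ ≤ ε
shrink {B} {ε} 0≤B 0<ε = δ , 0<δ , B*δ≤ε
  where
  instance
    posC : Positive (B + 1ℚ)
    posC = nonNeg+pos⇒pos B {{nonNegative 0≤B}} 1ℚ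
    nzC : NonZero (B + 1ℚ)
    nzC = pos⇒nonZero (B + 1ℚ)
  δ = 1/ (B + 1ℚ) * ε
  0<δ : 0ℚ < δ
  0<δ = subst (_< δ) (*-zeroʳ (1/ (B + 1ℚ)))
    (*-monoʳ-<-pos (1/ (B + 1ℚ)) {{1/pos⇒pos (B + 1ℚ)}} 0<ε)
  B*δ≤ε : B * δ ≤ ε
  B*δ≤ε = ≤-trans
    (*-monoʳ-≤-nonNeg δ {{nonNegative (<⇒≤ 0<δ)}} (p≤p+q {B} {1ℚ} (0≤ι/ 1 1)))
    (≤-reflexive (trans (sym (*-assoc (B + 1ℚ) (1/ (B + 1ℚ)) ε))
      (trans (cong (_* ε) (*-inverseʳ (B + 1ℚ))) (*-identityˡ ε))))

ι : ℕ → ℚ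
ι n = + n / 1

recip : ℕ → ℚ
recip k = + 1 / suc k

ι-suc : ∀ n → ι (suc n) ≡ ι n + 1ℚ
ι-suc n = toℚᵘ-injective (begin
  toℚᵘ (ι (suc n))       ≈⟨ toℚᵘ-fromℚᵘ _ ⟩
  (+ suc n) ᵘ./ 1        ≈⟨ ᵘ.*≡* (cong (ℤ._* + 1) num) ⟩
  (+ n) ᵘ./ 1 ᵘ.+ ᵘ.1ℚᵘ  ≈⟨ ᵘₚ.+-congˡ ᵘ.1ℚᵘ (toℚᵘ-fromℚᵘ ((+ n) ᵘ./ 1)) ⟨
  toℚᵘ (ι n) ᵘ.+ ᵘ.1ℚᵘ   ≈⟨ toℚᵘ-homo-+ (ι n) 1ℚ ⟨
  toℚᵘ (ι n + 1ℚ)        ∎)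
  where
  open ᵘₚ.≃-Reasoning
  num : + suc n ≡ + n ℤ.* + 1 ℤ.+ + 1 ℤ.* + 1
  num = trans (cong +_ (ℕₚ.+-comm 1 n)) (cong (ℤ._+ + 1) (sym (ℤₚ.*-identityʳ (+ n))))

ι*recip : ∀ k → ι (suc k) * recip k ≡ 1ℚ
ι*recip k = toℚᵘ-injective (begin
  toℚᵘ (ι (suc k) * recip k)            ≈⟨ toℚᵘ-homo-* (ι (suc k)) (recip k) ⟩
  toℚᵘ (ι (suc k)) ᵘ.* toℚᵘ (recip k)   ≈⟨ ᵘₚ.*-cong (toℚᵘ-fromℚᵘ ((+ suc k) ᵘ./ 1)) (toℚᵘ-fromℚᵘ ((+ 1) ᵘ./ suc k)) ⟩
  ((+ suc k) ᵘ./ 1) ᵘ.* ((+ 1) ᵘ./ suc k) ≈⟨ ᵘ.*≡* eq ⟩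
  ᵘ.1ℚᵘ                                 ∎)
  where
  open ᵘₚ.≃-Reasoning
  eq : (+ suc k ℤ.* + 1) ℤ.* + 1 ≡ + 1 ℤ.* + (1 ℕ.* suc k)
  eq = trans (ℤₚ.*-identityʳ _) (trans (ℤₚ.*-identityʳ _)
    (sym (trans (ℤₚ.*-identityˡ _) (cong +_ (ℕₚ.*-identityˡ (suc k))))))

ι-mono : ∀ {m n} → m ℕ.≤ n → ι m ≤ ι n
ι-mono {m} {n} m≤n = subst (λ n → ι m ≤ ι n) (ℕₚ.m+[n∸m]≡n m≤n) (go (n ℕ.∸ m))
  where
  go : ∀ d → ι m ≤ ι (m ℕ.+ d)
  go zero    = ≤-reflexive (cong ι (sym (ℕₚ.+-identityʳ m)))
  go (suc d) = ≤-trans (go d) (subst (ι (m ℕ.+ d) ≤_)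
    (trans (sym (ι-suc (m ℕ.+ d))) (cong ι (sym (ℕₚ.+-suc m d)))) (p≤p+q (0≤ι/ 1 1)))

≤-ι : ∀ q → ∃[ N ] q ≤ ι N
≤-ι q@(mkℚ (+ a) d _) = a , toℚᵘ-cancel-≤ (ᵘₚ.≤-trans {j = (+ a) ᵘ./ 1}
  (ᵘ.*≤* (ℤₚ.*-monoˡ-≤-nonNeg (+ a) {+ 1} {+ suc d} (ℤ.+≤+ (ℕ.s≤s ℕ.z≤n))))
  (ᵘₚ.≤-reflexive (ᵘₚ.≃-sym (toℚᵘ-fromℚᵘ ((+ a) ᵘ./ 1)))))
≤-ι q@(mkℚ -[1+ a ] d _) = 0 , <⇒≤ (negative⁻¹ q)

recip-≤ : ∀ {ε} → 0ℚ < ε → ∃[ N ] ∀ k → N ℕ.≤ k → recip k ≤ ε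
recip-≤ {ε} 0<ε = N , λ k N≤k → begin
  recip k                        ≡⟨ *-identityˡ (recip k) ⟨
  1ℚ * recip k                   ≡⟨ cong (_* recip k) (*-inverseˡ ε) ⟨
  1/ ε * ε * recip k             ≡⟨ solve 3 (λ a b c → a :* b :* c := b :* (a :* c)) refl (1/ ε) ε (recip k) ⟩
  ε * (1/ ε * recip k)           ≤⟨ *-monoˡ-≤-nonNeg ε (*-monoʳ-≤-nonNeg (recip k) {{recip≥0 k}}
                                      (≤-trans 1/ε≤N (ι-mono (ℕₚ.m≤n⇒m≤1+n N≤k)))) ⟩
  ε * (ι (suc k) * recip k)      ≡⟨ cong (ε *_) (ι*recip k) ⟩
  ε * 1ℚ                         ≡⟨ *-identityʳ ε ⟩
  ε                              ∎
  where
  open ≤-Reasoning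
  open +-*-Solver
  recip≥0 : ∀ k → NonNegative (recip k)
  recip≥0 k = normalize-nonNeg 1 (suc k)
  instance
    nzε : NonZero ε
    nzε = >-nonZero 0<ε
    nnε : NonNegative ε
    nnε = nonNegative (<⇒≤ 0<ε)
  N = proj₁ (≤-ι (1/ ε))
  1/ε≤N = proj₂ (≤-ι (1/ ε))

IsCauchy : (ℕ → ℚ) → Set
IsCauchy s = ∀ ε → 0ℚ < ε → ∃[ N ] ∀ m n → N ℕ.≤ m → N ℕ.≤ n → ∣ s m - s n ∣ ≤ ε

record ℝ : Set where
  constructor mkℝ
  field
    seq    : ℕ → ℚ
    cauchy : IsCauchy seq

open ℝ public

infix 4 _≃ᴿ_ _<ᴿ_

_≃ᴿ_ : Rel ℝ 0ℓ
x ≃ᴿ y = ∀ ε → 0ℚ < ε → ∃[ N ] ∀ n → N ℕ.≤ n → ∣ seq x n - seq y n ∣ ≤ ε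

_<ᴿ_ : Rel ℝ 0ℓ
x <ᴿ y = ∃[ ε ] 0ℚ < ε × ∃[ N ] ∀ n → N ℕ.≤ n → seq x n + ε ≤ seq y n

fromℚ : ℚ → ℝ
fromℚ q = mkℝ (λ _ → q) λ ε 0<ε → 0 , λ _ _ _ _ →
  subst (_≤ ε) (sym (cong ∣_∣ (+-inverseʳ q))) (<⇒≤ 0<ε)

0ᴿ 1ᴿ : ℝ
0ᴿ = fromℚ 0ℚ
1ᴿ = fromℚ 1ℚ

cauchy-≤ : ∀ {s} → (∀ ε → 0ℚ < ε → ∃[ N ] ∀ m n → N ℕ.≤ m → m ℕ.≤ n → ∣ s m - s n ∣ ≤ ε) → IsCauchy s
cauchy-≤ {s} h ε 0<ε = N , both
  where
  N = proj₁ (h ε 0<ε)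
  both : ∀ m n → N ℕ.≤ m → N ℕ.≤ n → ∣ s m - s n ∣ ≤ ε
  both m n N≤m N≤n with ℕₚ.≤-total m n
  ... | inj₁ m≤n = proj₂ (h ε 0<ε) m n N≤m m≤n
  ... | inj₂ n≤m = subst (_≤ ε) (∣-∣-comm (s n) (s m)) (proj₂ (h ε 0<ε) n m N≤n n≤m)

eventually-bounded : ∀ x → ∃[ B ] 0ℚ ≤ B × ∃[ N ] ∀ n → N ℕ.≤ n → ∣ seq x n ∣ ≤ B
eventually-bounded x = 1ℚ + ∣ seq x N ∣ , 0≤+ (0≤ι/ 1 1) (0≤∣p∣ (seq x N)) , N , λ n N≤n →
  subst (λ p → ∣ p ∣ ≤ 1ℚ + ∣ seq x N ∣)
    (solve 2 (λ a b → (a :- b) :+ b := a) refl (seq x n) (seq x N))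
    (∣+∣≤ (proj₂ c n N N≤n ℕₚ.≤-refl) ≤-refl)
  where
  open +-*-Solver
  c = cauchy x 1ℚ (positive⁻¹ 1ℚ)
  N = proj₁ c

infixl 6 _+ᴿ_
infixl 7 _*ᴿ_
infix  8 -ᴿ_

_+ᴿ_ : ℝ → ℝ → ℝ
x +ᴿ y = mkℝ (λ n → seq x n + seq y n) λ ε 0<ε →
  let N₁ , p = cauchy x (½ * ε) (0<½* 0<ε)
      N₂ , q = cauchy y (½ * ε) (0<½* 0<ε)
  in N₁ ℕ.⊔ N₂ , λ m n N≤m N≤n →
     subst₂ (λ a b → ∣ a ∣ ≤ b)
       (solve 4 (λ a b c d → (a :- b) :+ (c :- d) := (a :+ c) :- (b :+ d)) refl
         (seq x m) (seq x n) (seq y m) (seq y n))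
       (½+½ ε)
       (∣+∣≤ (p m n (ℕₚ.m⊔n≤o⇒m≤o N₁ N₂ N≤m) (ℕₚ.m⊔n≤o⇒m≤o N₁ N₂ N≤n))
             (q m n (ℕₚ.m⊔n≤o⇒n≤o N₁ N₂ N≤m) (ℕₚ.m⊔n≤o⇒n≤o N₁ N₂ N≤n)))
  where open +-*-Solver

-ᴿ_ : ℝ → ℝ
-ᴿ x = mkℝ (λ n → - seq x n) λ ε 0<ε →
  let N , p = cauchy x ε 0<ε
  in N , λ m n N≤m N≤n → subst (_≤ ε)
       (trans (∣-∣-comm (seq x m) (seq x n)) (cong ∣_∣
         (solve 2 (λ a b → b :- a := :- a :- :- b) refl (seq x m) (seq x n))))
       (p m n N≤m N≤n)
  where open +-*-Solver

_*ᴿ_ : ℝ → ℝ → ℝ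
x *ᴿ y = mkℝ (λ n → seq x n * seq y n) λ ε 0<ε →
  let B , 0≤B , N₁ , bx = eventually-bounded x
      C , 0≤C , N₂ , by = eventually-bounded y
      δ , 0<δ , Bδ≤ = shrink 0≤B (0<½* 0<ε)
      η , 0<η , Cη≤ = shrink 0≤C (0<½* 0<ε)
      N₃ , p = cauchy x η 0<η
      N₄ , q = cauchy y δ 0<δ
      N = (N₁ ℕ.⊔ N₂) ℕ.⊔ (N₃ ℕ.⊔ N₄)
      ≤₁ : ∀ {k} → N ℕ.≤ k → N₁ ℕ.≤ k
      ≤₁ h = ℕₚ.m⊔n≤o⇒m≤o N₁ N₂ (ℕₚ.m⊔n≤o⇒m≤o (N₁ ℕ.⊔ N₂) _ h)
      ≤₂ : ∀ {k} → N ℕ.≤ k → N₂ ℕ.≤ k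
      ≤₂ h = ℕₚ.m⊔n≤o⇒n≤o N₁ N₂ (ℕₚ.m⊔n≤o⇒m≤o (N₁ ℕ.⊔ N₂) _ h)
      ≤₃ : ∀ {k} → N ℕ.≤ k → N₃ ℕ.≤ k
      ≤₃ h = ℕₚ.m⊔n≤o⇒m≤o N₃ N₄ (ℕₚ.m⊔n≤o⇒n≤o (N₁ ℕ.⊔ N₂) _ h)
      ≤₄ : ∀ {k} → N ℕ.≤ k → N₄ ℕ.≤ k
      ≤₄ h = ℕₚ.m⊔n≤o⇒n≤o N₃ N₄ (ℕₚ.m⊔n≤o⇒n≤o (N₁ ℕ.⊔ N₂) _ h)
  in N , λ m n N≤m N≤n →
     subst₂ (λ a b → ∣ a ∣ ≤ b)
       (solve 4 (λ a b c d → a :* (c :- d) :+ d :* (a :- b) := a :* c :- b :* d) refl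
         (seq x m) (seq x n) (seq y m) (seq y n))
       (½+½ ε)
       (∣+∣≤ (≤-trans (∣*∣≤ (bx m (≤₁ N≤m)) (q m n (≤₄ N≤m) (≤₄ N≤n))) Bδ≤)
             (≤-trans (∣*∣≤ (by n (≤₂ N≤n)) (p m n (≤₃ N≤m) (≤₃ N≤n))) Cη≤))
  where open +-*-Solver

-- expTerm x k = xᵏ / k!
expTerm : ℚ → ℕ → ℚ
expTerm x zero    = 1ℚ
expTerm x (suc k) = expTerm x k * x * recip k

Σ< : ℕ → (ℕ → ℚ) → ℚ
Σ< zero    f = 0ℚ
Σ< (suc n) f = Σ< n f + f n

module _ {B : ℚ} (0≤B : 0ℚ ≤ B) where

  private
    e : ℕ → ℚ
    e = expTerm B

  expTerm≥0 : ∀ k → 0ℚ ≤ e k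
  expTerm≥0 zero    = 0≤ι/ 1 1
  expTerm≥0 (suc k) = 0≤* (0≤* (expTerm≥0 k) 0≤B) (0≤ι/ 1 (suc k))

  ∣recip∣≤ : ∀ k → ∣ recip k ∣ ≤ recip k
  ∣recip∣≤ k = ≤-reflexive (0≤p⇒∣p∣≡p (0≤ι/ 1 (suc k)))

  ∣expTerm∣≤ : ∀ {x} → ∣ x ∣ ≤ B → ∀ k → ∣ expTerm x k ∣ ≤ e k
  ∣expTerm∣≤ x≤ zero    = ≤-refl
  ∣expTerm∣≤ x≤ (suc k) = ∣*∣≤ (∣*∣≤ (∣expTerm∣≤ x≤ k) x≤) (∣recip∣≤ k)

  expTerm-lip : ∀ {x y} → ∣ x ∣ ≤ B → ∣ y ∣ ≤ B → ∀ k →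
    ∣ expTerm x (suc k) - expTerm y (suc k) ∣ ≤ ∣ x - y ∣ * e k
  expTerm-lip {x} {y} x≤ y≤ zero = ≤-reflexive (trans
    (cong ∣_∣ (solve 2 (λ x y → con 1ℚ :* x :* con 1ℚ :- con 1ℚ :* y :* con 1ℚ := x :- y) refl x y))
    (sym (*-identityʳ ∣ x - y ∣)))
    where open +-*-Solver
  expTerm-lip {x} {y} x≤ y≤ (suc k) = begin
    ∣ X * x * r - Y * y * r ∣
      ≡⟨ cong ∣_∣ (solve 5 (λ X Y x y r → X :* x :* r :- Y :* y :* r
           := ((X :- Y) :* x :+ Y :* (x :- y)) :* r) refl X Y x y r) ⟩
    ∣ ((X - Y) * x + Y * (x - y)) * r ∣
      ≤⟨ ∣*∣≤ (∣+∣≤ (∣*∣≤ (expTerm-lip x≤ y≤ k) x≤) (∣*∣≤ {b = d} (∣expTerm∣≤ y≤ (suc k)) ≤-refl)) (∣recip∣≤ (suc k)) ⟩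
    (d * e k * B + e (suc k) * d) * r
      ≡⟨ cong (λ z → (z + e (suc k) * d) * r) shift ⟩
    (d * e (suc k) * ι (suc k) + e (suc k) * d) * r
      ≡⟨ solve 4 (λ d e n r → (d :* e :* n :+ e :* d) :* r
           := d :* e :* ((n :+ con 1ℚ) :* r)) refl d (e (suc k)) (ι (suc k)) r ⟩
    d * e (suc k) * ((ι (suc k) + 1ℚ) * r)
      ≡⟨ cong (λ z → d * e (suc k) * (z * r)) (ι-suc (suc k)) ⟨
    d * e (suc k) * (ι (suc (suc k)) * r)
      ≡⟨ cong (d * e (suc k) *_) (ι*recip (suc k)) ⟩
    d * e (suc k) * 1ℚ
      ≡⟨ *-identityʳ _ ⟩
    d * e (suc k) ∎
    where
    open ≤-Reasoning
    open +-*-Solver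
    X = expTerm x (suc k)
    Y = expTerm y (suc k)
    r = recip (suc k)
    d = ∣ x - y ∣
    shift : d * e k * B ≡ d * e (suc k) * ι (suc k)
    shift = sym (trans
      (solve 5 (λ d e b r n → d :* (e :* b :* r) :* n := d :* e :* b :* (n :* r)) refl
        d (e k) B (recip k) (ι (suc k)))
      (trans (cong (d * e k * B *_) (ι*recip k)) (*-identityʳ _)))

  module _ {K : ℕ} (2B≤K : B + B ≤ ι K) where

    halving : ∀ k → K ℕ.≤ k → e (suc k) + e (suc k) ≤ e k
    halving k K≤k = begin
      e (suc k) + e (suc k)
        ≡⟨ solve 3 (λ e b r → e :* b :* r :+ e :* b :* r := e :* ((b :+ b) :* r)) refl (e k) B (recip k) ⟩
      e k * ((B + B) * recip k)
        ≤⟨ *-monoˡ-≤-nonNeg (e k) {{nonNegative (expTerm≥0 k)}}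
             (*-monoʳ-≤-nonNeg (recip k) {{normalize-nonNeg 1 (suc k)}}
               (≤-trans 2B≤K (ι-mono (ℕₚ.m≤n⇒m≤1+n K≤k)))) ⟩
      e k * (ι (suc k) * recip k) ≡⟨ cong (e k *_) (ι*recip k) ⟩
      e k * 1ℚ                    ≡⟨ *-identityʳ (e k) ⟩
      e k                         ∎
      where
      open ≤-Reasoning
      open +-*-Solver

    majorant : ∀ {m n} → K ℕ.≤ m → m ℕ.≤′ n → Σ< n e + (e n + e n) ≤ Σ< m e + (e m + e m)
    majorant K≤m ℕ.≤′-refl = ≤-refl
    majorant {m} K≤m (ℕ.≤′-step {n} m≤n) = ≤-trans
      (subst (Σ< n e + e n + (e (suc n) + e (suc n)) ≤_) (+-assoc (Σ< n e) (e n) (e n))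
        (+-monoʳ-≤ (Σ< n e + e n) (halving n (ℕₚ.≤-trans K≤m (ℕₚ.≤′⇒≤ m≤n)))))
      (majorant K≤m m≤n)

    expTerm-antitone : ∀ {n} → K ℕ.≤′ n → e n ≤ e K
    expTerm-antitone ℕ.≤′-refl = ≤-refl
    expTerm-antitone (ℕ.≤′-step {n} K≤n) = ≤-trans
      (≤-trans (p≤p+q (expTerm≥0 (suc n))) (halving n (ℕₚ.≤′⇒≤ K≤n)))
      (expTerm-antitone K≤n)

    expTerm-small : ∀ ε → 0ℚ < ε → ∃[ N ] ∀ n → N ℕ.≤ n → e n + e n ≤ ε
    expTerm-small ε 0<ε = suc (K ℕ.⊔ M) , small
      where
      open ≤-Reasoning
      open +-*-Solver
      δ∃ = shrink (0≤+ (0≤* (expTerm≥0 K) 0≤B) (0≤* (expTerm≥0 K) 0≤B)) 0<ε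
      δ = proj₁ δ∃
      M∃ = recip-≤ (proj₁ (proj₂ δ∃))
      M = proj₁ M∃
      eB = e K * B
      small : ∀ n → suc (K ℕ.⊔ M) ℕ.≤ n → e n + e n ≤ ε
      small (suc n) (ℕ.s≤s N≤n) = begin
        e n * B * recip n + e n * B * recip n
          ≤⟨ +-mono-≤ step step ⟩
        eB * δ + eB * δ
          ≡⟨ *-distribʳ-+ δ eB eB ⟨
        (eB + eB) * δ
          ≤⟨ proj₂ (proj₂ δ∃) ⟩
        ε ∎
        where
        step : e n * B * recip n ≤ eB * δ
        step = *-mono-≤₀ (0≤* (expTerm≥0 n) 0≤B)
          (*-monoʳ-≤-nonNeg B {{nonNegative 0≤B}}
            (expTerm-antitone (ℕₚ.≤⇒≤′ (ℕₚ.m⊔n≤o⇒m≤o K M N≤n))))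
          (0≤ι/ 1 (suc n)) (proj₂ M∃ n (ℕₚ.m⊔n≤o⇒n≤o K M N≤n))

  module _ {σ : ℕ → ℚ} (∣σ∣≤1 : ∀ k → ∣ σ k ∣ ≤ 1ℚ) where

    private
      t : ℚ → ℕ → ℚ
      t x k = σ k * expTerm x k

    Σ<-lip : ∀ {x y} → ∣ x ∣ ≤ B → ∣ y ∣ ≤ B → ∀ n →
      ∣ Σ< (suc n) (t x) - Σ< (suc n) (t y) ∣ ≤ ∣ x - y ∣ * Σ< n e
    Σ<-lip {x} {y} x≤ y≤ zero = ≤-trans
      (≤-reflexive (cong ∣_∣ (+-inverseʳ (0ℚ + σ 0 * 1ℚ))))
      (≤-reflexive (sym (*-zeroʳ ∣ x - y ∣)))
    Σ<-lip {x} {y} x≤ y≤ (suc k) = begin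
      ∣ Σ< n (t x) + t x n - (Σ< n (t y) + t y n) ∣
        ≡⟨ cong ∣_∣ (solve 5 (λ a b s p q → a :+ s :* p :- (b :+ s :* q)
             := (a :- b) :+ s :* (p :- q)) refl
             (Σ< n (t x)) (Σ< n (t y)) (σ n) (expTerm x n) (expTerm y n)) ⟩
      ∣ (Σ< n (t x) - Σ< n (t y)) + σ n * (expTerm x n - expTerm y n) ∣
        ≤⟨ ∣+∣≤ (Σ<-lip x≤ y≤ k) (∣*∣≤ (∣σ∣≤1 n) (expTerm-lip x≤ y≤ k)) ⟩
      d * Σ< k e + 1ℚ * (d * e k)
        ≡⟨ cong (λ z → d * Σ< k e + z) (*-identityˡ (d * e k)) ⟩
      d * Σ< k e + d * e k
        ≡⟨ *-distribˡ-+ d (Σ< k e) (e k) ⟨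
      d * Σ< (suc k) e ∎
      where
      open ≤-Reasoning
      open +-*-Solver
      n = suc k
      d = ∣ x - y ∣

    Σ<-tail : ∀ {x} → ∣ x ∣ ≤ B → ∀ {m n} → m ℕ.≤′ n →
      ∣ Σ< m (t x) - Σ< n (t x) ∣ ≤ Σ< n e - Σ< m e
    Σ<-tail {x} x≤ {m} ℕ.≤′-refl = ≤-reflexive (trans
      (cong ∣_∣ (+-inverseʳ (Σ< m (t x)))) (sym (+-inverseʳ (Σ< m e))))
    Σ<-tail {x} x≤ {m} (ℕ.≤′-step {n} m≤n) = begin
      ∣ Σ< m (t x) - (Σ< n (t x) + t x n) ∣
        ≡⟨ cong ∣_∣ (solve 3 (λ a b c → a :- (b :+ c) := (a :- b) :+ :- c) refl
             (Σ< m (t x)) (Σ< n (t x)) (t x n)) ⟩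
      ∣ (Σ< m (t x) - Σ< n (t x)) + - t x n ∣
        ≤⟨ ∣+∣≤ (Σ<-tail x≤ m≤n) (≤-trans (≤-reflexive (∣-p∣≡∣p∣ (t x n)))
             (∣*∣≤ (∣σ∣≤1 n) (∣expTerm∣≤ x≤ n))) ⟩
      (Σ< n e - Σ< m e) + 1ℚ * e n
        ≡⟨ solve 3 (λ a b c → (a :- b) :+ con 1ℚ :* c := (a :+ c) :- b) refl (Σ< n e) (Σ< m e) (e n) ⟩
      Σ< (suc n) e - Σ< m e ∎
      where
      open ≤-Reasoning
      open +-*-Solver

series-cauchy : ∀ {σ : ℕ → ℚ} → (∀ k → ∣ σ k ∣ ≤ 1ℚ) → ∀ x →
  IsCauchy (λ n → Σ< n (λ k → σ k * expTerm (seq x n) k))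
series-cauchy {σ} ∣σ∣≤1 x = cauchy-≤ {λ n → S n n} close
  where
  open ≤-Reasoning
  open +-*-Solver
  bound = eventually-bounded x
  B = proj₁ bound
  0≤B = proj₁ (proj₂ bound)
  N₁ = proj₁ (proj₂ (proj₂ bound))
  x≤B = proj₂ (proj₂ (proj₂ bound))
  K = proj₁ (≤-ι (B + B))
  2B≤K = proj₂ (≤-ι (B + B))
  e = expTerm B
  e≥0 = expTerm≥0 0≤B
  L = Σ< K e + (e K + e K)
  S : ℕ → ℕ → ℚ
  S m n = Σ< m (λ k → σ k * expTerm (seq x n) k)

  Σ≤L : ∀ {m} → K ℕ.≤ m → Σ< m e ≤ L
  Σ≤L {m} K≤m = ≤-trans (p≤p+q (0≤+ (e≥0 m) (e≥0 m)))
    (majorant 0≤B {K} 2B≤K ℕₚ.≤-refl (ℕₚ.≤⇒≤′ K≤m))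

  0≤Σ : ∀ n → 0ℚ ≤ Σ< n e
  0≤Σ zero    = ≤-refl
  0≤Σ (suc n) = 0≤+ (0≤Σ n) (e≥0 n)

  0≤L : 0ℚ ≤ L
  0≤L = 0≤+ (0≤Σ K) (0≤+ (e≥0 K) (e≥0 K))

  tail≤ : ∀ {m n} → K ℕ.≤ m → m ℕ.≤ n → Σ< n e - Σ< m e ≤ e m + e m
  tail≤ {m} {n} K≤m m≤n = begin
    Σ< n e - Σ< m e
      ≤⟨ +-monoˡ-≤ (- Σ< m e) {Σ< n e} (≤-trans (p≤p+q {Σ< n e} (0≤+ (e≥0 n) (e≥0 n)))
           (majorant 0≤B {K} 2B≤K K≤m (ℕₚ.≤⇒≤′ m≤n))) ⟩
    Σ< m e + (e m + e m) - Σ< m e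
      ≡⟨ solve 2 (λ a b → a :+ b :- a := b) refl (Σ< m e) (e m + e m) ⟩
    e m + e m ∎

  close : ∀ ε → 0ℚ < ε → ∃[ N ] ∀ m n → N ℕ.≤ m → m ℕ.≤ n → ∣ S m m - S n n ∣ ≤ ε
  close ε 0<ε = suc (N₁ ℕ.⊔ K ℕ.⊔ (N₂ ℕ.⊔ N₃)) , go
    where
    δ∃ = shrink 0≤L (0<½* 0<ε)
    c∃ = cauchy x (proj₁ δ∃) (proj₁ (proj₂ δ∃))
    N₂ = proj₁ c∃
    t∃ = expTerm-small 0≤B {K} 2B≤K (½ * ε) (0<½* 0<ε)
    N₃ = proj₁ t∃
    go : ∀ m n → suc (N₁ ℕ.⊔ K ℕ.⊔ (N₂ ℕ.⊔ N₃)) ℕ.≤ m → m ℕ.≤ n → ∣ S m m - S n n ∣ ≤ ε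
    go (suc m) n (ℕ.s≤s N≤m) m≤n = begin
      ∣ S (suc m) (suc m) - S n n ∣
        ≡⟨ cong ∣_∣ (solve 3 (λ a b c → a :- c := (a :- b) :+ (b :- c)) refl
             (S (suc m) (suc m)) (S (suc m) n) (S n n)) ⟩
      ∣ (S (suc m) (suc m) - S (suc m) n) + (S (suc m) n - S n n) ∣
        ≤⟨ ∣+∣≤ variation truncation ⟩
      ½ * ε + ½ * ε
        ≡⟨ ½+½ ε ⟩
      ε ∎
      where
      N₁K≤m = ℕₚ.m⊔n≤o⇒m≤o (N₁ ℕ.⊔ K) (N₂ ℕ.⊔ N₃) N≤m
      N₂₃≤m = ℕₚ.m⊔n≤o⇒n≤o (N₁ ℕ.⊔ K) (N₂ ℕ.⊔ N₃) N≤m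
      K≤m   = ℕₚ.m⊔n≤o⇒n≤o N₁ K N₁K≤m
      N₁≤m′ = ℕₚ.m≤n⇒m≤1+n (ℕₚ.m⊔n≤o⇒m≤o N₁ K N₁K≤m)
      N₂≤m′ = ℕₚ.m≤n⇒m≤1+n (ℕₚ.m⊔n≤o⇒m≤o N₂ N₃ N₂₃≤m)
      N₃≤m′ = ℕₚ.m≤n⇒m≤1+n (ℕₚ.m⊔n≤o⇒n≤o N₂ N₃ N₂₃≤m)
      xm≤B = x≤B (suc m) N₁≤m′
      xn≤B = x≤B n (ℕₚ.≤-trans N₁≤m′ m≤n)
      variation : ∣ S (suc m) (suc m) - S (suc m) n ∣ ≤ ½ * ε
      variation = begin
        ∣ S (suc m) (suc m) - S (suc m) n ∣
          ≤⟨ Σ<-lip 0≤B ∣σ∣≤1 xm≤B xn≤B m ⟩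
        ∣ seq x (suc m) - seq x n ∣ * Σ< m e
          ≤⟨ *-mono-≤₀ (0≤∣p∣ (seq x (suc m) - seq x n))
               (proj₂ c∃ (suc m) n N₂≤m′ (ℕₚ.≤-trans N₂≤m′ m≤n)) (0≤Σ m) (Σ≤L K≤m) ⟩
        proj₁ δ∃ * L
          ≡⟨ *-comm (proj₁ δ∃) L ⟩
        L * proj₁ δ∃
          ≤⟨ proj₂ (proj₂ δ∃) ⟩
        ½ * ε ∎
      truncation : ∣ S (suc m) n - S n n ∣ ≤ ½ * ε
      truncation = ≤-trans (Σ<-tail 0≤B ∣σ∣≤1 xn≤B (ℕₚ.≤⇒≤′ m≤n))
        (≤-trans (tail≤ (ℕₚ.m≤n⇒m≤1+n K≤m) m≤n) (proj₂ t∃ (suc m) N₃≤m′))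

-- Real and imaginary parts of 𝐢ᵏ.
re-𝐢^ im-𝐢^ : ℕ → ℚ
re-𝐢^ zero    = 1ℚ
re-𝐢^ (suc k) = - im-𝐢^ k
im-𝐢^ zero    = 0ℚ
im-𝐢^ (suc k) = re-𝐢^ k

∣re-𝐢^∣≤1 : ∀ k → ∣ re-𝐢^ k ∣ ≤ 1ℚ
∣im-𝐢^∣≤1 : ∀ k → ∣ im-𝐢^ k ∣ ≤ 1ℚ
∣re-𝐢^∣≤1 zero    = ≤-refl
∣re-𝐢^∣≤1 (suc k) = subst (_≤ 1ℚ) (sym (∣-p∣≡∣p∣ (im-𝐢^ k))) (∣im-𝐢^∣≤1 k)
∣im-𝐢^∣≤1 zero    = 0≤ι/ 1 1
∣im-𝐢^∣≤1 (suc k) = ∣re-𝐢^∣≤1 k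

-- cos x = Σₖ Re(𝐢ᵏ) xᵏ/k! and sin x = Σₖ Im(𝐢ᵏ) xᵏ/k!.  The n-th rational
-- approximation is the n-th partial sum at the n-th approximation of x; this
-- represents the sum of the series since the series converges uniformly on
-- bounded sets.
cos sin : ℝ → ℝ
cos x = mkℝ (λ n → Σ< n (λ k → re-𝐢^ k * expTerm (seq x n) k)) (series-cauchy ∣re-𝐢^∣≤1 x)
sin x = mkℝ (λ n → Σ< n (λ k → im-𝐢^ k * expTerm (seq x n) k)) (series-cauchy ∣im-𝐢^∣≤1 x)

-- π is twice the least positive zero of cos.
IsPi : ℝ → Set
IsPi π = 0ᴿ <ᴿ fromℚ ½ *ᴿ π
       × cos (fromℚ ½ *ᴿ π) ≃ᴿ 0ᴿ
       × (∀ x → 0ᴿ <ᴿ x → x <ᴿ fromℚ ½ *ᴿ π → ¬ cos x ≃ᴿ 0ᴿ)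

record ℂ : Set where
  constructor _+𝐢_
  field
    re im : ℝ

open ℂ public

infix 4 _≃ᶜ_
infixl 6 _+ᶜ_

_≃ᶜ_ : Rel ℂ 0ℓ
z ≃ᶜ w = re z ≃ᴿ re w × im z ≃ᴿ im w

0ᶜ -1ᶜ : ℂ
0ᶜ  = 0ᴿ +𝐢 0ᴿ
-1ᶜ = (-ᴿ 1ᴿ) +𝐢 0ᴿ

_+ᶜ_ : ℂ → ℂ → ℂ
z +ᶜ w = (re z +ᴿ re w) +𝐢 (im z +ᴿ im w)

-- ℤₙ is represented by the residues Fin n.
module _ {n : ℕ} .{{_ : ℕ.NonZero n}} where

  [_]ₙ : ℤ → Fin n
  [ z ]ₙ = fromℕ< (n%ℕd<d z n)

  infixl 6 _-ₙ_

  _-ₙ_ : Fin n → Fin n → Fin n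
  h -ₙ g = [ + toℕ h ℤ.- + toℕ g ]ₙ

record Graph (n : ℕ) : Set₁ where
  field
    _~_  : Rel (Fin n) 0ℓ
    _~?_ : Decidable _~_

-- Cay S is a simple undirected graph when 0 ∉ S = -S, as holds for the
-- connection set below if n is even and 0 < c < n/2.
Cay : ∀ {n} .{{_ : ℕ.NonZero n}} → Subset n → Graph n
Cay S = record { _~_ = λ g h → (h -ₙ g) ∈ S ; _~?_ = λ g h → (h -ₙ g) ∈? S }

-- A bijection ℓ : Fin n ⤖ Fin n stands for the labelling v ↦ 1 + ℓ v by {1,…,n}.
ClosedDistanceMagic : ∀ {n} → Graph n → Set
ClosedDistanceMagic {n} Γ =
  ∃[ ℓ ] ∃[ r ] 0 ℕ.< r × (∀ u → label ℓ u ℕ.+ sum (map (label ℓ) (filter (u ~?_) (allFin n))) ≡ r)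
  where
  open Graph Γ
  label : Fin n ⤖ Fin n → Fin n → ℕ
  label ℓ v = suc (toℕ (Bijection.to ℓ v))

connectionSet : ∀ n .{{_ : ℕ.NonZero n}} → ℕ → Subset n
connectionSet n c =
  ⁅ [ + 1 ]ₙ ⁆ ∪ ⁅ [ ℤ.- + 1 ]ₙ ⁆ ∪ ⁅ [ + c ]ₙ ⁆ ∪ ⁅ [ ℤ.- + c ]ₙ ⁆ ∪ ⁅ [ + (n /ℕ 2) ]ₙ ⁆

module _ (π : ℝ) {n : ℕ} .{{_ : ℕ.NonZero n}} where

  χ : Fin n → Fin n → ℂ
  χ j x = cos θ +𝐢 sin θ
    where
    θ : ℝ
    θ = fromℚ (+ (2 ℕ.* toℕ x ℕ.* toℕ j) / n) *ᴿ π

  χ[_] : Fin n → Subset n → ℂ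
  χ[ j ] S = foldr _+ᶜ_ 0ᶜ (map (χ j) (filter (_∈? S) (allFin n)))

  𝒥 : Subset n → Pred (Fin n) 0ℓ
  𝒥 S j = χ[ j ] S ≃ᶜ -1ᶜ

-- The subset {a, b} of ℝ.
⟅_,_⟆ : ℝ → ℝ → Pred ℝ 0ℓ
⟅ a , b ⟆ x = x ≃ᴿ a ⊎ x ≃ᴿ b

±_ : Sign → ℝ → ℝ
(± Sign.+) x = x
(± Sign.-) x = -ᴿ x

Type2 : ℝ → ∀ n .{{_ : ℕ.NonZero n}} → ℕ → Pred (Fin n) 0ℓ
Type2 π n c j = 2 ∣ toℕ j
  × 𝒥 π (connectionSet n c) j
  × (∃[ s₁ ] ∃[ s₂ ] ∃[ k₁ ] ∃[ k₂ ]
       ⟅ fromℚ (+ (2 ℕ.* toℕ j) / n) *ᴿ π , fromℚ (+ (2 ℕ.* toℕ j ℕ.* c) / n) *ᴿ π ⟆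
       ≐ ⟅ angle s₁ k₁ , angle s₂ k₂ ⟆)
  where
  angle : Sign → ℤ → ℝ
  angle s k = (± s) (fromℚ (+ 2 / 3) *ᴿ π) +ᴿ fromℚ ((+ 2 ℤ.* k) / 1) *ᴿ π

{-# OPTIONS --safe #-}
module Submission where

-- Cancelling π in 2πj/n = ±2π/3 + 2kπ gives 3j = (3k ± 1)n, so 0 ≤ j < n leaves
-- only 3j = n and 3j = 2n; the same equation for jc shows that 3 does not divide
-- c.  For the converse, the two candidates are complementary: i + j = n.  Then
-- χ_j(x) is the conjugate of χ_i(x), because its angle is 2πx minus that of
-- χ_i(x), and therefore χ_j(S) = -1 as soon as χ_i(S) = -1.  The 2π-periodicity
-- of cos and sin used here follows from cos(π/2) = 0 and the addition formulas,
-- that is, from the Cauchy product of the exponential series.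

open import Defs
open import Data.Nat.Base as ℕ using (ℕ; zero; suc)
import Data.Nat.Properties as ℕₚ
import Data.Nat.Divisibility as ℕᵈ
open import Data.Nat.DivMod using (m*n/n≡m; m*[n/m]≡n) renaming (_/_ to _/ℕ_)
open import Data.Nat.Coprimality using (coprime?; coprime-divisor)
import Data.Integer.Properties as ℤₚ
import Data.Integer.Divisibility.Signed as ℤᵈ
import Data.Integer.Solver as ℤSolver
open import Data.Sign.Base as Sign using (Sign)
import Data.Rational.Unnormalised.Base as ᵘ
import Data.Rational.Unnormalised.Properties as ᵘₚ
open import Data.Fin.Base using (Fin; toℕ)
open import Data.Fin.Properties using (toℕ-injective; toℕ<n)
open import Data.Fin.Subset.Properties using (_∈?_)
open import Data.List.Base using ([]; _∷_; foldr; map; filter; allFin)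
open import Data.Product.Base using (∃; ∃-syntax; _×_; _,_; proj₁; proj₂)
open import Data.Sum.Base using (_⊎_; inj₁; inj₂; [_,_]′)
open import Function.Bundles using (_⇔_; mk⇔)
open import Level using (0ℓ)
open import Relation.Binary.Bundles using (Setoid)
open import Relation.Binary.PropositionalEquality
import Relation.Binary.Reasoning.Setoid as SetoidReasoning
open import Relation.Nullary using (¬_; yes; no; contradiction)
open import Relation.Nullary.Decidable using (toWitness)
open import Relation.Unary using (_≐_)

-- No value such as cos(2π/3) is ever computed: one element of type 2 is given, and χ_j(S) = -1 is
-- only transported from it to its complement. The trigonometry thus reduces to exp(2k𝐢π) = 1,
-- parity and the addition formulas. The obstacle is the last of these, because `cos` and `sin` are
-- diagonal sequences, the n-th partial sum taken at the n-th rational approximation. Parity holds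
-- exactly at each index, whereas the two sides of an addition formula differ at index n by the
-- products of terms of degrees i, j < n with i + j ≥ n, and this error has to be bounded by the
-- tail of an exponential series. Once π is cancelled, the rest is arithmetic in ℤ: the multiplier
-- ±1 + 3k is prime to 3, and this one fact excludes both j = 0 and 3 ∣ c.

module _ where

  open import Data.Rational.Base
  open import Data.Rational.Properties
  open import Data.Rational.Solver using (module +-*-Solver)

  -- Finite sums and antidiagonal sums

  ∣Σ<∣-tail : ∀ {f e : ℕ → ℚ} → (∀ k → ∣ f k ∣ ≤ e k) → ∀ {m n} → m ℕ.≤′ n →
    ∣ Σ< n f - Σ< m f ∣ ≤ Σ< n e - Σ< m e
  ∣Σ<∣-tail {f} {e} f≤e {m} ℕ.≤′-refl = ≤-reflexive
    (trans (cong ∣_∣ (+-inverseʳ (Σ< m f))) (sym (+-inverseʳ (Σ< m e))))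
  ∣Σ<∣-tail {f} {e} f≤e {m} (ℕ.≤′-step {n} m≤n) = subst₂ (λ a b → ∣ a ∣ ≤ b)
    (swap (Σ< n f) (Σ< m f) (f n)) (swap (Σ< n e) (Σ< m e) (e n))
    (∣+∣≤ (∣Σ<∣-tail f≤e m≤n) (f≤e n))
    where
    open +-*-Solver
    swap : ∀ a b c → a - b + c ≡ a + c - b
    swap = solve 3 (λ a b c → a :- b :+ c := a :+ c :- b) refl

  Σ<-cong : ∀ {f g : ℕ → ℚ} → (∀ k → f k ≡ g k) → ∀ n → Σ< n f ≡ Σ< n g
  Σ<-cong h zero    = refl
  Σ<-cong h (suc n) = cong₂ _+_ (Σ<-cong h n) (h n)

  Σ<-+ : ∀ (f g : ℕ → ℚ) n → Σ< n (λ k → f k + g k) ≡ Σ< n f + Σ< n g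
  Σ<-+ f g zero    = refl
  Σ<-+ f g (suc n) = trans (cong (_+ (f n + g n)) (Σ<-+ f g n))
    (solve 4 (λ a b c d → a :+ b :+ (c :+ d) := a :+ c :+ (b :+ d)) refl (Σ< n f) (Σ< n g) (f n) (g n))
    where open +-*-Solver

  Σ<-*ˡ : ∀ c (f : ℕ → ℚ) n → Σ< n (λ k → c * f k) ≡ c * Σ< n f
  Σ<-*ˡ c f zero    = sym (*-zeroʳ c)
  Σ<-*ˡ c f (suc n) = trans (cong (_+ c * f n) (Σ<-*ˡ c f n)) (sym (*-distribˡ-+ c (Σ< n f) (f n)))

  Σ<-neg : ∀ (f : ℕ → ℚ) n → Σ< n (λ k → - f k) ≡ - Σ< n f
  Σ<-neg f zero    = refl
  Σ<-neg f (suc n) = trans (cong (_+ - f n) (Σ<-neg f n)) (sym (neg-distrib-+ (Σ< n f) (f n)))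

  Σ<-head : ∀ (f : ℕ → ℚ) n → Σ< (suc n) f ≡ f 0 + Σ< n (λ k → f (suc k))
  Σ<-head f zero    = +-comm 0ℚ (f 0)
  Σ<-head f (suc n) = trans (cong (_+ f (suc n)) (Σ<-head f n)) (+-assoc (f 0) _ _)

  0≤Σ< : ∀ {e : ℕ → ℚ} → (∀ k → 0ℚ ≤ e k) → ∀ n → 0ℚ ≤ Σ< n e
  0≤Σ< 0≤e zero    = ≤-refl
  0≤Σ< 0≤e (suc n) = 0≤+ (0≤Σ< 0≤e n) (0≤e n)

  Σ<-mono : ∀ {e : ℕ → ℚ} → (∀ k → 0ℚ ≤ e k) → ∀ {m n} → m ℕ.≤′ n → Σ< m e ≤ Σ< n e
  Σ<-mono 0≤e ℕ.≤′-refl       = ≤-refl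
  Σ<-mono 0≤e (ℕ.≤′-step {n} m≤n) = ≤-trans (Σ<-mono 0≤e m≤n) (p≤p+q (0≤e n))

  -- The k-th coefficient of a Cauchy product, a sum over i + j = k. Shifting `f` in its first
  -- argument makes the recursion structural and avoids the subtraction k - i.
  antidiag : (ℕ → ℕ → ℚ) → ℕ → ℚ
  antidiag f zero    = f 0 0
  antidiag f (suc k) = f 0 (suc k) + antidiag (λ i → f (suc i)) k

  -- Since i + j = k is available to the hypothesis, a factor that depends on k can be rewritten in
  -- terms of i and j.
  antidiag-cong : ∀ {f g : ℕ → ℕ → ℚ} k → (∀ i j → i ℕ.+ j ≡ k → f i j ≡ g i j) →
    antidiag f k ≡ antidiag g k
  antidiag-cong zero    h = h 0 0 refl
  antidiag-cong (suc k) h = cong₂ _+_ (h 0 (suc k) refl)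
    (antidiag-cong k λ i j i+j≡k → h (suc i) j (cong suc i+j≡k))

  antidiag-+ : ∀ (f g : ℕ → ℕ → ℚ) k → antidiag (λ i j → f i j + g i j) k ≡ antidiag f k + antidiag g k
  antidiag-+ f g zero    = refl
  antidiag-+ f g (suc k) = trans (cong (f 0 (suc k) + g 0 (suc k) +_) (antidiag-+ (λ i → f (suc i)) (λ i → g (suc i)) k))
    (solve 4 (λ a b c d → a :+ b :+ (c :+ d) := a :+ c :+ (b :+ d)) refl (f 0 (suc k)) (g 0 (suc k)) _ _)
    where open +-*-Solver

  antidiag-*ˡ : ∀ c (f : ℕ → ℕ → ℚ) k → antidiag (λ i j → c * f i j) k ≡ c * antidiag f k
  antidiag-*ˡ c f zero    = refl
  antidiag-*ˡ c f (suc k) = trans (cong (c * f 0 (suc k) +_) (antidiag-*ˡ c (λ i → f (suc i)) k))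
    (sym (*-distribˡ-+ c (f 0 (suc k)) _))

  -- Peels from the end j = 0 instead of i = 0; this is the summand that a factor `ι j` kills.
  antidiag-last : ∀ (f : ℕ → ℕ → ℚ) k → antidiag f (suc k) ≡ antidiag (λ i j → f i (suc j)) k + f (suc k) 0
  antidiag-last f zero    = refl
  antidiag-last f (suc k) = trans (cong (f 0 (suc (suc k)) +_) (antidiag-last (λ i → f (suc i)) k))
    (sym (+-assoc (f 0 (suc (suc k))) _ _))

  -- The binomial theorem for the terms xᵏ/k!

  ι-+ : ∀ m n → ι (m ℕ.+ n) ≡ ι m + ι n
  ι-+ zero    n = sym (+-identityˡ (ι n))
  ι-+ (suc m) n = begin
    ι (suc (m ℕ.+ n))  ≡⟨ ι-suc (m ℕ.+ n) ⟩
    ι (m ℕ.+ n) + 1ℚ   ≡⟨ cong (_+ 1ℚ) (ι-+ m n) ⟩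
    ι m + ι n + 1ℚ     ≡⟨ solve 2 (λ a b → a :+ b :+ con 1ℚ := a :+ con 1ℚ :+ b) refl (ι m) (ι n) ⟩
    ι m + 1ℚ + ι n     ≡⟨ cong (_+ ι n) (ι-suc m) ⟨
    ι (suc m) + ι n    ∎
    where
    open ≡-Reasoning
    open +-*-Solver

  expTerm-ι : ∀ x k → ι (suc k) * expTerm x (suc k) ≡ x * expTerm x k
  expTerm-ι x k = begin
    ι (suc k) * (expTerm x k * x * recip k)
      ≡⟨ solve 4 (λ a b c d → a :* (b :* c :* d) := c :* b :* (a :* d)) refl (ι (suc k)) (expTerm x k) x (recip k) ⟩
    x * expTerm x k * (ι (suc k) * recip k) ≡⟨ cong (x * expTerm x k *_) (ι*recip k) ⟩
    x * expTerm x k * 1ℚ                    ≡⟨ *-identityʳ _ ⟩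
    x * expTerm x k                         ∎
    where
    open ≡-Reasoning
    open +-*-Solver

  -- Multiplying by i + j = k + 1 and splitting the factor turns both halves
  -- into antidiagonal sums of order k.
  expTerm-+ : ∀ x y k → expTerm (x + y) k ≡ antidiag (λ i j → expTerm x i * expTerm y j) k
  expTerm-+ x y zero    = refl
  expTerm-+ x y (suc k) = begin
    expTerm (x + y) k * (x + y) * recip k
      ≡⟨ cong (λ z → z * (x + y) * recip k) (expTerm-+ x y k) ⟩
    A * (x + y) * recip k
      ≡⟨ cong (_* recip k) (trans (*-comm A (x + y)) (sym raise)) ⟩
    ι (suc k) * antidiag t (suc k) * recip k
      ≡⟨ solve 3 (λ a b c → a :* b :* c := b :* (a :* c)) refl (ι (suc k)) (antidiag t (suc k)) (recip k) ⟩
    antidiag t (suc k) * (ι (suc k) * recip k)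
      ≡⟨ cong (antidiag t (suc k) *_) (ι*recip k) ⟩
    antidiag t (suc k) * 1ℚ
      ≡⟨ *-identityʳ _ ⟩
    antidiag t (suc k) ∎
    where
    open ≡-Reasoning
    open +-*-Solver
    t : ℕ → ℕ → ℚ
    t i j = expTerm x i * expTerm y j
    A = antidiag t k
    left : antidiag (λ i j → ι i * t i j) (suc k) ≡ x * A
    left = begin
      ι 0 * t 0 (suc k) + antidiag (λ i j → ι (suc i) * t (suc i) j) k
        ≡⟨ cong₂ _+_ (*-zeroˡ (t 0 (suc k))) (antidiag-cong k λ i j _ → trans
             (sym (*-assoc (ι (suc i)) (expTerm x (suc i)) (expTerm y j)))
             (trans (cong (_* expTerm y j) (expTerm-ι x i)) (*-assoc x (expTerm x i) (expTerm y j)))) ⟩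
      0ℚ + antidiag (λ i j → x * t i j) k
        ≡⟨ trans (+-identityˡ _) (antidiag-*ˡ x t k) ⟩
      x * A ∎
    right : antidiag (λ i j → ι j * t i j) (suc k) ≡ y * A
    right = begin
      antidiag (λ i j → ι j * t i j) (suc k)
        ≡⟨ antidiag-last (λ i j → ι j * t i j) k ⟩
      antidiag (λ i j → ι (suc j) * t i (suc j)) k + ι 0 * t (suc k) 0
        ≡⟨ cong₂ _+_ (antidiag-cong k λ i j _ → trans
             (solve 3 (λ a b c → a :* (b :* c) := b :* (a :* c)) refl (ι (suc j)) (expTerm x i) (expTerm y (suc j)))
             (trans (cong (expTerm x i *_) (expTerm-ι y j))
               (solve 3 (λ a b c → b :* (a :* c) := a :* (b :* c)) refl y (expTerm x i) (expTerm y j))))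
             (*-zeroˡ (t (suc k) 0)) ⟩
      antidiag (λ i j → y * t i j) k + 0ℚ
        ≡⟨ trans (+-identityʳ _) (antidiag-*ˡ y t k) ⟩
      y * A ∎
    raise : ι (suc k) * antidiag t (suc k) ≡ (x + y) * A
    raise = begin
      ι (suc k) * antidiag t (suc k)
        ≡⟨ antidiag-*ˡ (ι (suc k)) t (suc k) ⟨
      antidiag (λ i j → ι (suc k) * t i j) (suc k)
        ≡⟨ antidiag-cong (suc k) (λ i j i+j≡ → trans
             (cong (_* t i j) (trans (cong ι (sym i+j≡)) (ι-+ i j))) (*-distribʳ-+ (t i j) (ι i) (ι j))) ⟩
      antidiag (λ i j → ι i * t i j + ι j * t i j) (suc k)
        ≡⟨ antidiag-+ (λ i j → ι i * t i j) (λ i j → ι j * t i j) (suc k) ⟩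
      antidiag (λ i j → ι i * t i j) (suc k) + antidiag (λ i j → ι j * t i j) (suc k)
        ≡⟨ cong₂ _+_ left right ⟩
      x * A + y * A
        ≡⟨ *-distribʳ-+ A x y ⟨
      (x + y) * A ∎

  -- Index regions of the Cauchy product, and bounds for the exponential series

  -- The region i + j < n, cut into rows: row i has n - i entries. Row by row it can be compared
  -- with a rectangle, antidiagonal by antidiagonal with a power series.
  triangle : (ℕ → ℕ → ℚ) → ℕ → ℚ
  triangle f zero    = 0ℚ
  triangle f (suc n) = Σ< (suc n) (f 0) + triangle (λ i → f (suc i)) n

  rectangle : (ℕ → ℕ → ℚ) → ℕ → ℕ → ℚ
  rectangle f zero    m = 0ℚ
  rectangle f (suc n) m = Σ< m (f 0) + rectangle (λ i → f (suc i)) n m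

  Σ<-antidiag : ∀ (f : ℕ → ℕ → ℚ) n → Σ< n (antidiag f) ≡ triangle f n
  Σ<-antidiag f zero    = refl
  Σ<-antidiag f (suc n) = begin
    Σ< (suc n) (antidiag f)
      ≡⟨ Σ<-head (antidiag f) n ⟩
    f 0 0 + Σ< n (λ k → f 0 (suc k) + antidiag f′ k)
      ≡⟨ cong (f 0 0 +_) (trans (Σ<-+ _ _ n) (cong (Σ< n (λ k → f 0 (suc k)) +_) (Σ<-antidiag f′ n))) ⟩
    f 0 0 + (Σ< n (λ k → f 0 (suc k)) + triangle f′ n)
      ≡⟨ +-assoc (f 0 0) _ _ ⟨
    f 0 0 + Σ< n (λ k → f 0 (suc k)) + triangle f′ n
      ≡⟨ cong (_+ triangle f′ n) (Σ<-head (f 0) n) ⟨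
    triangle f (suc n) ∎
    where
    open ≡-Reasoning
    f′ : ℕ → ℕ → ℚ
    f′ i = f (suc i)

  rectangle-* : ∀ (a b : ℕ → ℚ) n m → rectangle (λ i j → a i * b j) n m ≡ Σ< n a * Σ< m b
  rectangle-* a b zero    m = sym (*-zeroˡ (Σ< m b))
  rectangle-* a b (suc n) m = begin
    Σ< m (λ j → a 0 * b j) + rectangle (λ i j → a (suc i) * b j) n m
      ≡⟨ cong₂ _+_ (Σ<-*ˡ (a 0) b m) (rectangle-* (λ i → a (suc i)) b n m) ⟩
    a 0 * Σ< m b + Σ< n (λ i → a (suc i)) * Σ< m b
      ≡⟨ *-distribʳ-+ (Σ< m b) (a 0) _ ⟨
    (a 0 + Σ< n (λ i → a (suc i))) * Σ< m b
      ≡⟨ cong (_* Σ< m b) (Σ<-head a n) ⟨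
    Σ< (suc n) a * Σ< m b ∎
    where open ≡-Reasoning

  -- For n ≤ m every row of the rectangle prolongs the corresponding row of the triangle, so both
  -- differences are sums over the same outside indices, and the triangle inequality applies row by
  -- row.
  ∣rectangle-triangle∣≤ : ∀ {f e : ℕ → ℕ → ℚ} → (∀ i j → ∣ f i j ∣ ≤ e i j) → ∀ n {m} → n ℕ.≤ m →
    ∣ rectangle f n m - triangle f n ∣ ≤ rectangle e n m - triangle e n
  ∣rectangle-triangle∣≤ f≤e zero    n≤m = ≤-refl
  ∣rectangle-triangle∣≤ {f} {e} f≤e (suc n) {m} n<m = subst₂ (λ a b → ∣ a ∣ ≤ b)
    (swap (Σ< m (f 0)) (Σ< (suc n) (f 0)) _ _) (swap (Σ< m (e 0)) (Σ< (suc n) (e 0)) _ _)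
    (∣+∣≤ (∣Σ<∣-tail (f≤e 0) (ℕₚ.≤⇒≤′ n<m)) (∣rectangle-triangle∣≤ (λ i → f≤e (suc i)) n (ℕₚ.<⇒≤ n<m)))
    where
    open +-*-Solver
    swap : ∀ a b c d → a - b + (c - d) ≡ a + c - (b + d)
    swap = solve 4 (λ a b c d → a :- b :+ (c :- d) := a :+ c :- (b :+ d)) refl

  -- From i < n and j < m follows i + j < n + m; the additional entries of the triangle are
  -- nonnegative.
  rectangle≤triangle : ∀ {e : ℕ → ℕ → ℚ} → (∀ i j → 0ℚ ≤ e i j) → ∀ n m → rectangle e n m ≤ triangle e (n ℕ.+ m)
  rectangle≤triangle         0≤e zero zero    = ≤-refl
  rectangle≤triangle         0≤e zero (suc m) = 0≤+ (0≤Σ< (0≤e 0) (suc m)) (rectangle≤triangle (λ i → 0≤e (suc i)) zero m)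
  rectangle≤triangle         0≤e (suc n) m    = +-mono-≤
    (Σ<-mono (0≤e 0) (ℕₚ.≤⇒≤′ (ℕₚ.m≤n+m m (suc n))))
    (rectangle≤triangle (λ i → 0≤e (suc i)) n m)

  -- From an index K ≥ 2B on, each term is at most half of the preceding one, so the partial sum
  -- plus twice the next term no longer increases. `L` is the value of this majorant at K; smaller n
  -- are reached through n ⊔ K.
  exp-bounded : ∀ {B} → 0ℚ ≤ B → ∃[ L ] 0ℚ ≤ L × (∀ n → Σ< n (expTerm B) ≤ L)
  exp-bounded {B} 0≤B = L , 0≤+ (0≤Σ< e≥0 K) (0≤+ (e≥0 K) (e≥0 K)) , bounded
    where
    e = expTerm B
    e≥0 = expTerm≥0 0≤B
    K = proj₁ (≤-ι (B + B))
    L = Σ< K e + (e K + e K)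
    bounded : ∀ n → Σ< n e ≤ L
    bounded n = ≤-trans (Σ<-mono e≥0 (ℕₚ.≤⇒≤′ (ℕₚ.m≤m⊔n n K)))
      (≤-trans (p≤p+q (0≤+ (e≥0 (n ℕ.⊔ K)) (e≥0 (n ℕ.⊔ K))))
        (majorant 0≤B {K} (proj₂ (≤-ι (B + B))) ℕₚ.≤-refl (ℕₚ.≤⇒≤′ (ℕₚ.m≤n⊔m n K))))

  -- The same majorant started at n: by geometric decay the tail is at most twice its first term.
  exp-tail : ∀ {B} → 0ℚ ≤ B → ∀ ε → 0ℚ < ε → ∃[ N ] ∀ n m → N ℕ.≤ n → n ℕ.≤ m →
    Σ< m (expTerm B) - Σ< n (expTerm B) ≤ ε
  exp-tail {B} 0≤B ε 0<ε = K ℕ.⊔ M , tail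
    where
    open ≤-Reasoning
    open +-*-Solver
    e = expTerm B
    e≥0 = expTerm≥0 0≤B
    K = proj₁ (≤-ι (B + B))
    small = expTerm-small 0≤B {K} (proj₂ (≤-ι (B + B))) ε 0<ε
    M = proj₁ small
    tail : ∀ n m → K ℕ.⊔ M ℕ.≤ n → n ℕ.≤ m → Σ< m e - Σ< n e ≤ ε
    tail n m N≤n n≤m = begin
      Σ< m e - Σ< n e
        ≤⟨ +-monoˡ-≤ (- Σ< n e) (≤-trans (p≤p+q {Σ< m e} (0≤+ (e≥0 m) (e≥0 m)))
             (majorant 0≤B {K} (proj₂ (≤-ι (B + B))) (ℕₚ.m⊔n≤o⇒m≤o K M N≤n) (ℕₚ.≤⇒≤′ n≤m))) ⟩
      Σ< n e + (e n + e n) - Σ< n e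
        ≡⟨ solve 2 (λ a b → a :+ b :- a := b) refl (Σ< n e) (e n + e n) ⟩
      e n + e n
        ≤⟨ proj₂ small n (ℕₚ.m⊔n≤o⇒n≤o K M N≤n) ⟩
      ε ∎

  -- Equality of reals and its compatibility with the operations

  -- A record, so that, unlike with _≃ᴿ_, the two reals can be inferred.  Reals
  -- built by operations are nevertheless passed explicitly: by η for ℝ, unifying
  -- them would compare their Cauchy moduli.
  infix 4 _≈_
  record _≈_ (x y : ℝ) : Set where
    constructor ⟪_⟫
    field ≈⇒≃ : x ≃ᴿ y

  open _≈_

  pointwise : ∀ {x y} → (∀ n → seq x n ≡ seq y n) → x ≈ y
  pointwise {x} {y} h = ⟪ (λ ε 0<ε → 0 , λ n _ → ≤-trans (≤-reflexive
    (cong ∣_∣ (trans (cong (_- seq y n) (h n)) (+-inverseʳ (seq y n))))) (<⇒≤ 0<ε)) ⟫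

  ≈-refl : ∀ {x} → x ≈ x
  ≈-refl = pointwise (λ _ → refl)

  ≈-sym : ∀ {x y} → x ≈ y → y ≈ x
  ≈-sym {x} {y} ⟪ p ⟫ = ⟪ (λ ε 0<ε → let N , h = p ε 0<ε in
    N , λ n N≤n → subst (_≤ ε) (∣-∣-comm (seq x n) (seq y n)) (h n N≤n)) ⟫

  ≈-trans : ∀ {x y z} → x ≈ y → y ≈ z → x ≈ z
  ≈-trans {x} {y} {z} ⟪ p ⟫ ⟪ q ⟫ = ⟪ (λ ε 0<ε →
    let N₁ , f = p (½ * ε) (0<½* 0<ε)
        N₂ , g = q (½ * ε) (0<½* 0<ε)
    in N₁ ℕ.⊔ N₂ , λ n N≤n → subst₂ (λ a b → ∣ a ∣ ≤ b)
         (solve 3 (λ a b c → (a :- b) :+ (b :- c) := a :- c) refl (seq x n) (seq y n) (seq z n))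
         (½+½ ε)
         (∣+∣≤ (f n (ℕₚ.m⊔n≤o⇒m≤o N₁ N₂ N≤n)) (g n (ℕₚ.m⊔n≤o⇒n≤o N₁ N₂ N≤n)))) ⟫
    where open +-*-Solver

  ℝ-setoid : Setoid 0ℓ 0ℓ
  ℝ-setoid = record
    { Carrier = ℝ ; _≈_ = _≈_
    ; isEquivalence = record { refl = ≈-refl ; sym = ≈-sym ; trans = ≈-trans } }

  +ᴿ-cong : ∀ {x x′ y y′} → x ≈ x′ → y ≈ y′ → x +ᴿ y ≈ x′ +ᴿ y′
  +ᴿ-cong {x} {x′} {y} {y′} ⟪ p ⟫ ⟪ q ⟫ = ⟪ (λ ε 0<ε →
    let N₁ , f = p (½ * ε) (0<½* 0<ε)
        N₂ , g = q (½ * ε) (0<½* 0<ε)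
    in N₁ ℕ.⊔ N₂ , λ n N≤n → subst₂ (λ a b → ∣ a ∣ ≤ b)
         (solve 4 (λ a b c d → (a :- b) :+ (c :- d) := (a :+ c) :- (b :+ d)) refl
           (seq x n) (seq x′ n) (seq y n) (seq y′ n))
         (½+½ ε)
         (∣+∣≤ (f n (ℕₚ.m⊔n≤o⇒m≤o N₁ N₂ N≤n)) (g n (ℕₚ.m⊔n≤o⇒n≤o N₁ N₂ N≤n)))) ⟫
    where open +-*-Solver

  -ᴿ-cong : ∀ {x y} → x ≈ y → -ᴿ x ≈ -ᴿ y
  -ᴿ-cong {x} {y} ⟪ p ⟫ = ⟪ (λ ε 0<ε → let N , h = p ε 0<ε in
    N , λ n N≤n → subst (_≤ ε) (trans (∣-∣-comm (seq x n) (seq y n)) (cong ∣_∣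
      (solve 2 (λ a b → b :- a := :- a :- :- b) refl (seq x n) (seq y n)))) (h n N≤n)) ⟫
    where open +-*-Solver

  *ᴿ-congˡ : ∀ x {y y′} → y ≈ y′ → x *ᴿ y ≈ x *ᴿ y′
  *ᴿ-congˡ x {y} {y′} ⟪ p ⟫ = ⟪ (λ ε 0<ε →
    let B , 0≤B , N₁ , bx = eventually-bounded x
        δ , 0<δ , Bδ≤ = shrink 0≤B 0<ε
        N₂ , f = p δ 0<δ
    in N₁ ℕ.⊔ N₂ , λ n N≤n → subst (λ a → ∣ a ∣ ≤ ε)
         (solve 3 (λ a b c → a :* (b :- c) := a :* b :- a :* c) refl (seq x n) (seq y n) (seq y′ n))
         (≤-trans (∣*∣≤ (bx n (ℕₚ.m⊔n≤o⇒m≤o N₁ N₂ N≤n)) (f n (ℕₚ.m⊔n≤o⇒n≤o N₁ N₂ N≤n))) Bδ≤)) ⟫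
    where open +-*-Solver

  *ᴿ-comm : ∀ x y → x *ᴿ y ≈ y *ᴿ x
  *ᴿ-comm x y = pointwise {x *ᴿ y} {y *ᴿ x} λ n → *-comm (seq x n) (seq y n)

  *ᴿ-cong : ∀ {x x′ y y′} → x ≈ x′ → y ≈ y′ → x *ᴿ y ≈ x′ *ᴿ y′
  *ᴿ-cong {x} {x′} {y} {y′} p q = begin
    x *ᴿ y    ≈⟨ *ᴿ-congˡ x {y} {y′} q ⟩
    x *ᴿ y′   ≈⟨ *ᴿ-comm x y′ ⟩
    y′ *ᴿ x   ≈⟨ *ᴿ-congˡ y′ {x} {x′} p ⟩
    y′ *ᴿ x′  ≈⟨ *ᴿ-comm y′ x′ ⟩
    x′ *ᴿ y′  ∎
    where open SetoidReasoning ℝ-setoid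

  -- Power series with coefficients σ k / k!, and their products

  -- `cos` and `sin` are by definition the instances `re-𝐢^` and `im-𝐢^`. Keeping σ general also
  -- admits the coefficients of -sin, which the addition formula of `cos` calls for.
  series : (σ : ℕ → ℚ) → (∀ k → ∣ σ k ∣ ≤ 1ℚ) → ℝ → ℝ
  series σ ∣σ∣≤1 x = mkℝ (λ n → Σ< n (λ k → σ k * expTerm (seq x n) k)) (series-cauchy ∣σ∣≤1 x)

  -- All partial sums are Lipschitz on the interval from -B to B with one constant `L`, a bound for
  -- the partial sums of exp B. Here B = `Bx + By` serves both arguments at once.
  series-cong : ∀ {σ : ℕ → ℚ} (∣σ∣≤1 : ∀ k → ∣ σ k ∣ ≤ 1ℚ) {x y} → x ≈ y →
    series σ ∣σ∣≤1 x ≈ series σ ∣σ∣≤1 y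
  series-cong {σ} ∣σ∣≤1 {x} {y} ⟪ p ⟫ = ⟪ close ⟫
    where
    open ≤-Reasoning
    bx = eventually-bounded x
    by = eventually-bounded y
    Bx = proj₁ bx
    By = proj₁ by
    0≤Bx = proj₁ (proj₂ bx)
    0≤By = proj₁ (proj₂ by)
    B = Bx + By
    0≤B : 0ℚ ≤ B
    0≤B = 0≤+ 0≤Bx 0≤By
    N₁ = proj₁ (proj₂ (proj₂ bx))
    N₂ = proj₁ (proj₂ (proj₂ by))
    bounded = exp-bounded 0≤B
    L = proj₁ bounded
    close : series σ ∣σ∣≤1 x ≃ᴿ series σ ∣σ∣≤1 y
    -- `Σ<-lip` bounds a sum of n + 1 terms, so the index must be a successor.
    close ε 0<ε = suc N , go
      where
      δ∃ = shrink (proj₁ (proj₂ bounded)) 0<ε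
      δ = proj₁ δ∃
      p∃ = p δ (proj₁ (proj₂ δ∃))
      N = N₁ ℕ.⊔ N₂ ℕ.⊔ proj₁ p∃
      go : ∀ n → suc N ℕ.≤ n → ∣ seq (series σ ∣σ∣≤1 x) n - seq (series σ ∣σ∣≤1 y) n ∣ ≤ ε
      go (suc n) (ℕ.s≤s N≤n) = begin
        ∣ seq (series σ ∣σ∣≤1 x) (suc n) - seq (series σ ∣σ∣≤1 y) (suc n) ∣
          ≤⟨ Σ<-lip 0≤B ∣σ∣≤1
               (≤-trans (proj₂ (proj₂ (proj₂ bx)) (suc n) N₁≤) (p≤p+q 0≤By))
               (≤-trans (proj₂ (proj₂ (proj₂ by)) (suc n) N₂≤)
                 (subst (By ≤_) (+-comm By Bx) (p≤p+q 0≤Bx))) n ⟩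
        ∣ seq x (suc n) - seq y (suc n) ∣ * Σ< n (expTerm B)
          ≤⟨ *-mono-≤₀ (0≤∣p∣ _) (proj₂ p∃ (suc n) N₃≤)
               (0≤Σ< (expTerm≥0 0≤B) n) (proj₂ (proj₂ bounded) n) ⟩
        δ * L  ≡⟨ *-comm δ L ⟩
        L * δ  ≤⟨ proj₂ (proj₂ δ∃) ⟩
        ε      ∎
        where
        N≤ = ℕₚ.m≤n⇒m≤1+n N≤n
        N₁≤ = ℕₚ.m⊔n≤o⇒m≤o N₁ N₂ (ℕₚ.m⊔n≤o⇒m≤o (N₁ ℕ.⊔ N₂) (proj₁ p∃) N≤)
        N₂≤ = ℕₚ.m⊔n≤o⇒n≤o N₁ N₂ (ℕₚ.m⊔n≤o⇒m≤o (N₁ ℕ.⊔ N₂) (proj₁ p∃) N≤)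
        N₃≤ = ℕₚ.m⊔n≤o⇒n≤o (N₁ ℕ.⊔ N₂) (proj₁ p∃) N≤

  term : (ℕ → ℚ) → ℚ → ℕ → ℚ
  term σ x k = σ k * expTerm x k

  -- The terms outside the triangle are dominated by a tail of the series of
  -- exp (B + C), where B and C bound x and y.
  cauchy-product : ∀ {σ τ : ℕ → ℚ} → (∀ k → ∣ σ k ∣ ≤ 1ℚ) → (∀ k → ∣ τ k ∣ ≤ 1ℚ) → ∀ x y ε → 0ℚ < ε →
    ∃[ N ] ∀ n → N ℕ.≤ n →
      ∣ triangle (λ i j → term σ (seq x n) i * term τ (seq y n) j) n
        - Σ< n (term σ (seq x n)) * Σ< n (term τ (seq y n)) ∣ ≤ ε
  cauchy-product {σ} {τ} ∣σ∣≤1 ∣τ∣≤1 x y ε 0<ε = N , close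
    where
    open ≤-Reasoning
    bx = eventually-bounded x
    by = eventually-bounded y
    B = proj₁ bx
    C = proj₁ by
    0≤B = proj₁ (proj₂ bx)
    0≤C = proj₁ (proj₂ by)
    N₁ = proj₁ (proj₂ (proj₂ bx))
    N₂ = proj₁ (proj₂ (proj₂ by))
    tail = exp-tail (0≤+ 0≤B 0≤C) ε 0<ε
    N = N₁ ℕ.⊔ N₂ ℕ.⊔ proj₁ tail
    E : ℕ → ℕ → ℚ
    E i j = expTerm B i * expTerm C j
    -- By the binomial theorem the triangle of the majorants is exactly a partial sum of exp (B +
    -- C), and the n by n square lies in the triangle of size 2n. The error therefore becomes the
    -- block of that series from n to 2n.
    triangle-E : ∀ n → triangle E n ≡ Σ< n (expTerm (B + C))
    triangle-E n = sym (trans (Σ<-cong (expTerm-+ B C) n) (Σ<-antidiag E n))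
    ∣term∣≤ : ∀ {ρ : ℕ → ℚ} → (∀ k → ∣ ρ k ∣ ≤ 1ℚ) → ∀ {D} → 0ℚ ≤ D → ∀ {z} → ∣ z ∣ ≤ D →
      ∀ k → ∣ term ρ z k ∣ ≤ expTerm D k
    ∣term∣≤ {ρ} ρ≤ {D} 0≤D {z} z≤ k = subst (∣ term ρ z k ∣ ≤_) (*-identityˡ (expTerm D k))
      (∣*∣≤ (ρ≤ k) (∣expTerm∣≤ 0≤D z≤ k))
    close : ∀ n → N ℕ.≤ n → ∣ triangle (λ i j → term σ (seq x n) i * term τ (seq y n) j) n
      - Σ< n (term σ (seq x n)) * Σ< n (term τ (seq y n)) ∣ ≤ ε
    close n N≤n = begin
      ∣ triangle f n - Σ< n (term σ (seq x n)) * Σ< n (term τ (seq y n)) ∣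
        ≡⟨ cong (λ z → ∣ triangle f n - z ∣) (rectangle-* (term σ (seq x n)) (term τ (seq y n)) n n) ⟨
      ∣ triangle f n - rectangle f n n ∣
        ≡⟨ ∣-∣-comm (triangle f n) (rectangle f n n) ⟩
      ∣ rectangle f n n - triangle f n ∣
        ≤⟨ ∣rectangle-triangle∣≤ (λ i j → ∣*∣≤
             (∣term∣≤ ∣σ∣≤1 0≤B (proj₂ (proj₂ (proj₂ bx)) n N₁≤n) i)
             (∣term∣≤ ∣τ∣≤1 0≤C (proj₂ (proj₂ (proj₂ by)) n N₂≤n) j)) n ℕₚ.≤-refl ⟩
      rectangle E n n - triangle E n
        ≤⟨ +-monoˡ-≤ (- triangle E n)
             (rectangle≤triangle (λ i j → 0≤* (expTerm≥0 0≤B i) (expTerm≥0 0≤C j)) n n) ⟩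
      triangle E (n ℕ.+ n) - triangle E n
        ≡⟨ cong₂ _-_ (triangle-E (n ℕ.+ n)) (triangle-E n) ⟩
      Σ< (n ℕ.+ n) (expTerm (B + C)) - Σ< n (expTerm (B + C))
        ≤⟨ proj₂ tail n (n ℕ.+ n) (ℕₚ.m⊔n≤o⇒n≤o (N₁ ℕ.⊔ N₂) (proj₁ tail) N≤n) (ℕₚ.m≤m+n n n) ⟩
      ε ∎
      where
      f : ℕ → ℕ → ℚ
      f i j = term σ (seq x n) i * term τ (seq y n) j
      N₁≤n = ℕₚ.m⊔n≤o⇒m≤o N₁ N₂ (ℕₚ.m⊔n≤o⇒m≤o (N₁ ℕ.⊔ N₂) (proj₁ tail) N≤n)
      N₂≤n = ℕₚ.m⊔n≤o⇒n≤o N₁ N₂ (ℕₚ.m⊔n≤o⇒m≤o (N₁ ℕ.⊔ N₂) (proj₁ tail) N≤n)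

  -- Under the splitting of σ (i + j), each coefficient at x + y is exactly the sum of two
  -- antidiagonals, so the only error comes from the two Cauchy products. The two-product form
  -- covers the real and the imaginary part of 𝐢ⁱ⁺ʲ = 𝐢ⁱ𝐢ʲ alike.
  series-+ : ∀ {σ α β γ δ : ℕ → ℚ} (σ≤ : ∀ k → ∣ σ k ∣ ≤ 1ℚ)
    (α≤ : ∀ k → ∣ α k ∣ ≤ 1ℚ) (β≤ : ∀ k → ∣ β k ∣ ≤ 1ℚ)
    (γ≤ : ∀ k → ∣ γ k ∣ ≤ 1ℚ) (δ≤ : ∀ k → ∣ δ k ∣ ≤ 1ℚ) →
    (∀ i j → σ (i ℕ.+ j) ≡ α i * β j + γ i * δ j) → ∀ x y →
    series σ σ≤ (x +ᴿ y) ≈ series α α≤ x *ᴿ series β β≤ y +ᴿ series γ γ≤ x *ᴿ series δ δ≤ y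
  series-+ {σ} {α} {β} {γ} {δ} σ≤ α≤ β≤ γ≤ δ≤ split x y = ⟪ (λ ε 0<ε →
    let N₁ , p = cauchy-product α≤ β≤ x y (½ * ε) (0<½* 0<ε)
        N₂ , q = cauchy-product γ≤ δ≤ x y (½ * ε) (0<½* 0<ε)
    in N₁ ℕ.⊔ N₂ , λ n N≤n → subst₂ (λ a b → ∣ a ∣ ≤ b)
         (trans (rearrange (triangle (f n) n) (triangle (g n) n) _ _) (cong (_- _) (sym (expand n))))
         (½+½ ε)
         (∣+∣≤ (p n (ℕₚ.m⊔n≤o⇒m≤o N₁ N₂ N≤n)) (q n (ℕₚ.m⊔n≤o⇒n≤o N₁ N₂ N≤n)))) ⟫
    where
    open ≡-Reasoning
    open +-*-Solver
    f g : ℕ → ℕ → ℕ → ℚ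
    f n i j = term α (seq x n) i * term β (seq y n) j
    g n i j = term γ (seq x n) i * term δ (seq y n) j
    rearrange : ∀ a b c d → a - c + (b - d) ≡ a + b - (c + d)
    rearrange = solve 4 (λ a b c d → a :- c :+ (b :- d) := a :+ b :- (c :+ d)) refl
    coefficient : ∀ n k → term σ (seq x n + seq y n) k ≡ antidiag (f n) k + antidiag (g n) k
    coefficient n k = begin
      σ k * expTerm (X + Y) k
        ≡⟨ cong (σ k *_) (expTerm-+ X Y k) ⟩
      σ k * antidiag (λ i j → expTerm X i * expTerm Y j) k
        ≡⟨ antidiag-*ˡ (σ k) (λ i j → expTerm X i * expTerm Y j) k ⟨
      antidiag (λ i j → σ k * (expTerm X i * expTerm Y j)) k
        ≡⟨ antidiag-cong k (λ i j i+j≡k → trans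
             (cong (_* (expTerm X i * expTerm Y j)) (trans (cong σ (sym i+j≡k)) (split i j)))
             (solve 6 (λ a b c d u v → (a :* b :+ c :* d) :* (u :* v)
                := a :* u :* (b :* v) :+ c :* u :* (d :* v)) refl
                (α i) (β j) (γ i) (δ j) (expTerm X i) (expTerm Y j))) ⟩
      antidiag (λ i j → f n i j + g n i j) k
        ≡⟨ antidiag-+ (f n) (g n) k ⟩
      antidiag (f n) k + antidiag (g n) k ∎
      where
      X = seq x n
      Y = seq y n
    expand : ∀ n → Σ< n (term σ (seq x n + seq y n)) ≡ triangle (f n) n + triangle (g n) n
    expand n = begin
      Σ< n (term σ (seq x n + seq y n))
        ≡⟨ Σ<-cong (coefficient n) n ⟩
      Σ< n (λ k → antidiag (f n) k + antidiag (g n) k)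
        ≡⟨ Σ<-+ (antidiag (f n)) (antidiag (g n)) n ⟩
      Σ< n (antidiag (f n)) + Σ< n (antidiag (g n))
        ≡⟨ cong₂ _+_ (Σ<-antidiag (f n) n) (Σ<-antidiag (g n) n) ⟩
      triangle (f n) n + triangle (g n) n ∎

  -- Addition formulas and parity of cos and sin

  -- The factor `re-𝐢^ (suc j)` is `- im-𝐢^ j` by definition: the minus sign is hidden in a
  -- coefficient sequence to match the sum that `series-+` expects. Multiplication by 𝐢 exchanges
  -- the two parts, hence the mutual induction.
  re-𝐢^-+ : ∀ i j → re-𝐢^ (i ℕ.+ j) ≡ re-𝐢^ i * re-𝐢^ j + im-𝐢^ i * re-𝐢^ (suc j)
  im-𝐢^-+ : ∀ i j → im-𝐢^ (i ℕ.+ j) ≡ re-𝐢^ i * im-𝐢^ j + im-𝐢^ i * re-𝐢^ j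
  re-𝐢^-+ zero    j = solve 2 (λ a b → a := con 1ℚ :* a :+ con 0ℚ :* :- b) refl (re-𝐢^ j) (im-𝐢^ j)
    where open +-*-Solver
  re-𝐢^-+ (suc i) j = trans (cong -_ (im-𝐢^-+ i j))
    (solve 4 (λ a b c d → :- (a :* d :+ b :* c) := :- b :* c :+ a :* :- d) refl
      (re-𝐢^ i) (im-𝐢^ i) (re-𝐢^ j) (im-𝐢^ j))
    where open +-*-Solver
  im-𝐢^-+ zero    j = solve 2 (λ a b → b := con 1ℚ :* b :+ con 0ℚ :* a) refl (re-𝐢^ j) (im-𝐢^ j)
    where open +-*-Solver
  im-𝐢^-+ (suc i) j = trans (re-𝐢^-+ i j)
    (solve 4 (λ a b c d → a :* c :+ b :* :- d := :- b :* d :+ a :* c) refl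
      (re-𝐢^ i) (im-𝐢^ i) (re-𝐢^ j) (im-𝐢^ j))
    where open +-*-Solver

  cos-cong : ∀ {x y} → x ≈ y → cos x ≈ cos y
  cos-cong = series-cong ∣re-𝐢^∣≤1

  sin-cong : ∀ {x y} → x ≈ y → sin x ≈ sin y
  sin-cong = series-cong ∣im-𝐢^∣≤1

  cos-+ : ∀ x y → cos (x +ᴿ y) ≈ cos x *ᴿ cos y +ᴿ sin x *ᴿ (-ᴿ sin y)
  cos-+ x y = begin
    cos (x +ᴿ y)
      ≈⟨ ⟪ ≈⇒≃ (series-+ ∣re-𝐢^∣≤1 ∣re-𝐢^∣≤1 ∣re-𝐢^∣≤1 ∣im-𝐢^∣≤1 (λ k → ∣re-𝐢^∣≤1 (suc k)) re-𝐢^-+ x y) ⟫ ⟩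
    cos x *ᴿ cos y +ᴿ sin x *ᴿ -sin
      ≈⟨ +ᴿ-cong {cos x *ᴿ cos y} {cos x *ᴿ cos y} {sin x *ᴿ -sin} {sin x *ᴿ (-ᴿ sin y)}
           ≈-refl (*ᴿ-congˡ (sin x) { -sin} { -ᴿ sin y} (pointwise λ n → trans
             (Σ<-cong (λ k → sym (neg-distribˡ-* (im-𝐢^ k) (expTerm (seq y n) k))) n)
             (Σ<-neg (term im-𝐢^ (seq y n)) n))) ⟩
    cos x *ᴿ cos y +ᴿ sin x *ᴿ (-ᴿ sin y) ∎
    where
    open SetoidReasoning ℝ-setoid
    -sin = series (λ k → re-𝐢^ (suc k)) (λ k → ∣re-𝐢^∣≤1 (suc k)) y

  sin-+ : ∀ x y → sin (x +ᴿ y) ≈ cos x *ᴿ sin y +ᴿ sin x *ᴿ cos y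
  sin-+ x y = ⟪ ≈⇒≃ (series-+ ∣im-𝐢^∣≤1 ∣re-𝐢^∣≤1 ∣im-𝐢^∣≤1 ∣im-𝐢^∣≤1 ∣re-𝐢^∣≤1 im-𝐢^-+ x y) ⟫

  -- Passing from k to k + 1 multiplies the term by 𝐢x/(k + 1), which exchanges even and odd parts;
  -- so each parity is derived from the other one degree below.
  re-term-neg : ∀ x k → term re-𝐢^ (- x) k ≡ term re-𝐢^ x k
  im-term-neg : ∀ x k → term im-𝐢^ (- x) k ≡ - term im-𝐢^ x k
  re-term-neg x zero    = refl
  re-term-neg x (suc k) = trans
    (solve 4 (λ s e x r → :- s :* (e :* :- x :* r) := s :* e :* (x :* r)) refl
      (im-𝐢^ k) (expTerm (- x) k) x (recip k))
    (trans (cong (_* (x * recip k)) (im-term-neg x k))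
      (solve 4 (λ s e x r → :- (s :* e) :* (x :* r) := :- s :* (e :* x :* r)) refl
        (im-𝐢^ k) (expTerm x k) x (recip k)))
    where open +-*-Solver
  im-term-neg x zero    = refl
  im-term-neg x (suc k) = trans
    (solve 4 (λ s e x r → s :* (e :* :- x :* r) := :- (s :* e :* (x :* r))) refl
      (re-𝐢^ k) (expTerm (- x) k) x (recip k))
    (trans (cong (λ z → - (z * (x * recip k))) (re-term-neg x k))
      (solve 4 (λ s e x r → :- (s :* e :* (x :* r)) := :- (s :* (e :* x :* r))) refl
        (re-𝐢^ k) (expTerm x k) x (recip k)))
    where open +-*-Solver

  cos-neg : ∀ x → cos (-ᴿ x) ≈ cos x
  cos-neg x = pointwise λ n → Σ<-cong (re-term-neg (seq x n)) n

  sin-neg : ∀ x → sin (-ᴿ x) ≈ -ᴿ sin x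
  sin-neg x = pointwise λ n → trans (Σ<-cong (im-term-neg (seq x n)) n) (Σ<-neg (term im-𝐢^ (seq x n)) n)

  series-0 : ∀ {σ : ℕ → ℚ} (∣σ∣≤1 : ∀ k → ∣ σ k ∣ ≤ 1ℚ) → series σ ∣σ∣≤1 0ᴿ ≈ fromℚ (σ 0)
  -- The threshold is 1 because the partial sum at index 0 is empty and misses σ 0.
  series-0 {σ} ∣σ∣≤1 = ⟪ (λ ε 0<ε → 1 , λ n 1≤n → ≤-trans (≤-reflexive
    (cong ∣_∣ (trans (cong (_- σ 0) (value n 1≤n)) (+-inverseʳ (σ 0))))) (<⇒≤ 0<ε)) ⟫
    where
    open +-*-Solver
    vanish : ∀ k → term σ 0ℚ (suc k) ≡ 0ℚ * σ (suc k)
    vanish k = solve 3 (λ s e r → s :* (e :* con 0ℚ :* r) := con 0ℚ :* s) refl (σ (suc k)) (expTerm 0ℚ k) (recip k)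
    value : ∀ n → 1 ℕ.≤ n → Σ< n (term σ 0ℚ) ≡ σ 0
    value (suc n) _ = trans (Σ<-head (term σ 0ℚ) n) (trans
      (cong (term σ 0ℚ 0 +_) (trans (Σ<-cong vanish n) (Σ<-*ˡ 0ℚ (λ k → σ (suc k)) n)))
      (solve 2 (λ s t → s :* con 1ℚ :+ con 0ℚ :* t := s) refl (σ 0) (Σ< n (λ k → σ (suc k)))))

  -- This is the addition formula for cos (x - x) = cos 0 = 1, with the signs removed by parity.
  sin²+cos² : ∀ x → cos x *ᴿ cos x +ᴿ sin x *ᴿ sin x ≈ 1ᴿ
  sin²+cos² x = begin
    cos x *ᴿ cos x +ᴿ sin x *ᴿ sin x
      ≈⟨ +ᴿ-cong {cos x *ᴿ cos x} {cos x *ᴿ cos (-ᴿ x)} {sin x *ᴿ sin x} {sin x *ᴿ (-ᴿ sin (-ᴿ x))}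
           (*ᴿ-congˡ (cos x) {cos x} {cos (-ᴿ x)} (≈-sym {cos (-ᴿ x)} {cos x} (cos-neg x)))
           (*ᴿ-congˡ (sin x) {sin x} { -ᴿ sin (-ᴿ x)} sin≈) ⟩
    cos x *ᴿ cos (-ᴿ x) +ᴿ sin x *ᴿ (-ᴿ sin (-ᴿ x))
      ≈⟨ cos-+ x (-ᴿ x) ⟨
    cos (x +ᴿ (-ᴿ x))
      ≈⟨ cos-cong {x +ᴿ (-ᴿ x)} {0ᴿ} (pointwise λ n → +-inverseʳ (seq x n)) ⟩
    cos 0ᴿ
      ≈⟨ series-0 ∣re-𝐢^∣≤1 ⟩
    1ᴿ ∎
    where
    open SetoidReasoning ℝ-setoid
    open +-*-Solver
    sin≈ : sin x ≈ -ᴿ sin (-ᴿ x)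
    sin≈ = begin
      sin x            ≈⟨ pointwise {sin x} { -ᴿ (-ᴿ sin x)} (λ n → solve 1 (λ s → s := :- (:- s)) refl (seq (sin x) n)) ⟩
      -ᴿ (-ᴿ sin x)    ≈⟨ -ᴿ-cong {sin (-ᴿ x)} { -ᴿ sin x} (sin-neg x) ⟨
      -ᴿ sin (-ᴿ x)    ∎

  -- Values at multiples of π, and cancellation of π

  -- exp(𝐢t) = p + 𝐢q
  Direction : ℝ → ℚ → ℚ → Set
  Direction t p q = cos t ≈ fromℚ p × sin t ≈ fromℚ q

  direction-cong : ∀ {s t p q} → s ≈ t → Direction s p q → Direction t p q
  direction-cong {s} {t} {p} {q} s≈t (c , d) =
    ≈-trans {cos t} {cos s} {fromℚ p} (cos-cong {t} {s} (≈-sym {s} {t} s≈t)) c ,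
    ≈-trans {sin t} {sin s} {fromℚ q} (sin-cong {t} {s} (≈-sym {s} {t} s≈t)) d

  direction-0 : Direction 0ᴿ 1ℚ 0ℚ
  direction-0 = series-0 ∣re-𝐢^∣≤1 , series-0 ∣im-𝐢^∣≤1

  direction-+ : ∀ {s t p q u v a b} → Direction s p q → Direction t u v →
    p * u + q * - v ≡ a → p * v + q * u ≡ b → Direction (s +ᴿ t) a b
  direction-+ {s} {t} {p} {q} {u} {v} {a} {b} (cs , ss) (ct , st) re≡ im≡ =
    (begin
      cos (s +ᴿ t)
        ≈⟨ cos-+ s t ⟩
      cos s *ᴿ cos t +ᴿ sin s *ᴿ (-ᴿ sin t)
        ≈⟨ +ᴿ-cong {cos s *ᴿ cos t} {fromℚ p *ᴿ fromℚ u} {sin s *ᴿ (-ᴿ sin t)} {fromℚ q *ᴿ (-ᴿ fromℚ v)}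
             (*ᴿ-cong {cos s} {fromℚ p} {cos t} {fromℚ u} cs ct)
             (*ᴿ-cong {sin s} {fromℚ q} { -ᴿ sin t} { -ᴿ fromℚ v} ss (-ᴿ-cong {sin t} {fromℚ v} st)) ⟩
      fromℚ p *ᴿ fromℚ u +ᴿ fromℚ q *ᴿ (-ᴿ fromℚ v)
        ≈⟨ pointwise (λ _ → re≡) ⟩
      fromℚ a ∎) ,
    (begin
      sin (s +ᴿ t)
        ≈⟨ sin-+ s t ⟩
      cos s *ᴿ sin t +ᴿ sin s *ᴿ cos t
        ≈⟨ +ᴿ-cong {cos s *ᴿ sin t} {fromℚ p *ᴿ fromℚ v} {sin s *ᴿ cos t} {fromℚ q *ᴿ fromℚ u}
             (*ᴿ-cong {cos s} {fromℚ p} {sin t} {fromℚ v} cs st)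
             (*ᴿ-cong {sin s} {fromℚ q} {cos t} {fromℚ u} ss ct) ⟩
      fromℚ p *ᴿ fromℚ v +ᴿ fromℚ q *ᴿ fromℚ u
        ≈⟨ pointwise (λ _ → im≡) ⟩
      fromℚ b ∎)
    where open SetoidReasoning ℝ-setoid

  -- Writing cos 2h as 2 cos² h - (cos² h + sin² h) gives -1 without determining sin h, not even its
  -- sign.
  direction-double : ∀ {h} → cos h ≈ 0ᴿ → Direction (h +ᴿ h) (- 1ℚ) 0ℚ
  direction-double {h} cos≈0 =
    (begin
      cos (h +ᴿ h)
        ≈⟨ cos-+ h h ⟩
      cos h *ᴿ cos h +ᴿ sin h *ᴿ (-ᴿ sin h)
        ≈⟨ pointwise (λ n → solve 2 (λ c s → c :* c :+ s :* :- s := (c :* c :+ c :* c) :+ :- (c :* c :+ s :* s)) refl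
             (seq (cos h) n) (seq (sin h) n)) ⟩
      cos h *ᴿ cos h +ᴿ cos h *ᴿ cos h +ᴿ (-ᴿ (cos h *ᴿ cos h +ᴿ sin h *ᴿ sin h))
        ≈⟨ +ᴿ-cong {cos h *ᴿ cos h +ᴿ cos h *ᴿ cos h} {0ᴿ *ᴿ 0ᴿ +ᴿ 0ᴿ *ᴿ 0ᴿ} { -ᴿ (cos h *ᴿ cos h +ᴿ sin h *ᴿ sin h)} { -ᴿ 1ᴿ}
             (+ᴿ-cong {cos h *ᴿ cos h} {0ᴿ *ᴿ 0ᴿ} {cos h *ᴿ cos h} {0ᴿ *ᴿ 0ᴿ} cos²≈0 cos²≈0)
             (-ᴿ-cong {cos h *ᴿ cos h +ᴿ sin h *ᴿ sin h} {1ᴿ} (sin²+cos² h)) ⟩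
      0ᴿ *ᴿ 0ᴿ +ᴿ 0ᴿ *ᴿ 0ᴿ +ᴿ (-ᴿ 1ᴿ)
        ≈⟨ pointwise (λ _ → refl) ⟩
      fromℚ (- 1ℚ) ∎) ,
    (begin
      sin (h +ᴿ h)
        ≈⟨ sin-+ h h ⟩
      cos h *ᴿ sin h +ᴿ sin h *ᴿ cos h
        ≈⟨ +ᴿ-cong {cos h *ᴿ sin h} {0ᴿ *ᴿ sin h} {sin h *ᴿ cos h} {sin h *ᴿ 0ᴿ}
             (*ᴿ-cong {cos h} {0ᴿ} {sin h} {sin h} cos≈0 ≈-refl) (*ᴿ-congˡ (sin h) {cos h} {0ᴿ} cos≈0) ⟩
      0ᴿ *ᴿ sin h +ᴿ sin h *ᴿ 0ᴿ
        ≈⟨ pointwise (λ n → solve 1 (λ s → con 0ℚ :* s :+ s :* con 0ℚ := con 0ℚ) refl (seq (sin h) n)) ⟩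
      0ᴿ ∎)
    where
    open SetoidReasoning ℝ-setoid
    open +-*-Solver
    cos²≈0 : cos h *ᴿ cos h ≈ 0ᴿ *ᴿ 0ᴿ
    cos²≈0 = *ᴿ-cong {cos h} {0ᴿ} {cos h} {0ᴿ} cos≈0 cos≈0

  module _ {π : ℝ} (isPi : IsPi π) where

    direction-π : Direction π (- 1ℚ) 0ℚ
    direction-π = direction-cong {h +ᴿ h} {π} (pointwise λ n → ½+½ (seq π n))
      (direction-double {h} ⟪ proj₁ (proj₂ isPi) ⟫)
      where h = fromℚ ½ *ᴿ π

    direction-+2π : ∀ p → Direction (fromℚ p *ᴿ π) 1ℚ 0ℚ → Direction (fromℚ (p + (1ℚ + 1ℚ)) *ᴿ π) 1ℚ 0ℚ
    direction-+2π p d = direction-cong {fromℚ p *ᴿ π +ᴿ (π +ᴿ π)} {fromℚ (p + (1ℚ + 1ℚ)) *ᴿ π} {1ℚ} {0ℚ}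
      (pointwise λ n → solve 2 (λ a p → a :* p :+ (p :+ p) := (a :+ (con 1ℚ :+ con 1ℚ)) :* p) refl p (seq π n))
      (direction-+ {fromℚ p *ᴿ π} {π +ᴿ π} {1ℚ} {0ℚ} {1ℚ} {0ℚ} {1ℚ} {0ℚ} d
        (direction-+ {π} {π} { - 1ℚ} {0ℚ} { - 1ℚ} {0ℚ} {1ℚ} {0ℚ} direction-π direction-π refl refl) refl refl)
      where open +-*-Solver

    direction-2kπ : ∀ k {p} → ι k + ι k ≡ p → Direction (fromℚ p *ᴿ π) 1ℚ 0ℚ
    direction-2kπ zero {p} 0≡p = subst (λ p → Direction (fromℚ p *ᴿ π) 1ℚ 0ℚ) {0ℚ} {p} 0≡p
      (direction-cong {0ᴿ} {fromℚ 0ℚ *ᴿ π} {1ℚ} {0ℚ} (pointwise λ n → sym (*-zeroˡ (seq π n))) direction-0)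
    direction-2kπ (suc k) {p} 2k+2≡p = subst (λ p → Direction (fromℚ p *ᴿ π) 1ℚ 0ℚ)
      {ι k + ι k + (1ℚ + 1ℚ)} {p} (trans two-more 2k+2≡p)
      (direction-+2π (ι k + ι k) (direction-2kπ k refl))
      where
      open +-*-Solver
      two-more : ι k + ι k + (1ℚ + 1ℚ) ≡ ι (suc k) + ι (suc k)
      two-more = trans
        (solve 1 (λ a → a :+ a :+ (con 1ℚ :+ con 1ℚ) := a :+ con 1ℚ :+ (a :+ con 1ℚ)) refl (ι k))
        (cong₂ _+_ (sym (ι-suc k)) (sym (ι-suc k)))

    -- Positivity of π/2 provides ε with π/2 ≥ ε eventually. If d = ∣p - q∣ were positive, the two
    -- products would eventually be at least 2dε apart, against their equality up to dε. Equality in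
    -- ℚ is decidable, so the argument by contradiction is constructive.
    fromℚ*π-injective : ∀ {p q} → fromℚ p *ᴿ π ≈ fromℚ q *ᴿ π → p ≡ q
    fromℚ*π-injective {p} {q} ⟪ h ⟫ with p ≟ q
    ... | yes p≡q = p≡q
    ... | no  p≢q = contradiction refl (<⇒≢ (begin-strict
      d * ε                                ≡⟨ +-identityˡ (d * ε) ⟨
      0ℚ + d * ε                           <⟨ +-monoˡ-< (d * ε) 0<dε ⟩
      d * ε + d * ε                        ≤⟨ +-mono-≤ dε≤ dε≤ ⟩
      d * (½ * seq π n) + d * (½ * seq π n) ≡⟨ solve 2 (λ d p → d :* (con ½ :* p) :+ d :* (con ½ :* p) := d :* p) refl d (seq π n) ⟩
      d * seq π n                          ≤⟨ *-monoˡ-≤-nonNeg d {{nonNegative (0≤∣p∣ (p - q))}} (p≤∣p∣ (seq π n)) ⟩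
      d * ∣ seq π n ∣                      ≡⟨ ∣p*q∣≡∣p∣*∣q∣ (p - q) (seq π n) ⟨
      ∣ (p - q) * seq π n ∣                ≡⟨ cong ∣_∣ (solve 3 (λ p q x → (p :- q) :* x := p :* x :- q :* x) refl p q (seq π n)) ⟩
      ∣ p * seq π n - q * seq π n ∣        ≤⟨ proj₂ close n (ℕₚ.m≤n⊔m N _) ⟩
      d * ε                                ∎))
      where
      open ≤-Reasoning
      open +-*-Solver
      d = ∣ p - q ∣
      ε = proj₁ (proj₁ isPi)
      0<ε = proj₁ (proj₂ (proj₁ isPi))
      N = proj₁ (proj₂ (proj₂ (proj₁ isPi)))
      0<d : 0ℚ < d
      0<d = ≰⇒> λ d≤0 → p≢q (p-q≡0⇒p≡q (∣p∣≡0⇒p≡0 (p - q) (≤-antisym d≤0 (0≤∣p∣ (p - q)))))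
        where
        p-q≡0⇒p≡q : p - q ≡ 0ℚ → p ≡ q
        p-q≡0⇒p≡q eq = trans (solve 2 (λ p q → p := p :- q :+ q) refl p q)
          (trans (cong (_+ q) eq) (+-identityˡ q))
      0<dε : 0ℚ < d * ε
      0<dε = subst (_< d * ε) (*-zeroʳ d) (*-monoʳ-<-pos d {{positive 0<d}} 0<ε)
      close = h (d * ε) 0<dε
      n = N ℕ.⊔ proj₁ close
      dε≤ : d * ε ≤ d * (½ * seq π n)
      dε≤ = *-monoˡ-≤-nonNeg d {{nonNegative (0≤∣p∣ (p - q))}} (subst (_≤ ½ * seq π n) (+-identityˡ ε)
        (proj₂ (proj₂ (proj₂ (proj₁ isPi))) n (ℕₚ.m≤m⊔n N _)))
      p≤∣p∣ : ∀ r → r ≤ ∣ r ∣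
      p≤∣p∣ r with ≤-total 0ℚ r
      ... | inj₁ 0≤r = ≤-reflexive (sym (0≤p⇒∣p∣≡p 0≤r))
      ... | inj₂ r≤0 = ≤-trans r≤0 (0≤∣p∣ r)

  cos-reflect : ∀ {t x y} → Direction t 1ℚ 0ℚ → y ≈ t +ᴿ (-ᴿ x) → cos y ≈ cos x
  cos-reflect {t} {x} {y} (c , s) y≈t-x = begin
    cos y
      ≈⟨ cos-cong {y} {t +ᴿ (-ᴿ x)} y≈t-x ⟩
    cos (t +ᴿ (-ᴿ x))
      ≈⟨ cos-+ t (-ᴿ x) ⟩
    cos t *ᴿ cos (-ᴿ x) +ᴿ sin t *ᴿ (-ᴿ sin (-ᴿ x))
      ≈⟨ +ᴿ-cong {cos t *ᴿ cos (-ᴿ x)} {1ᴿ *ᴿ cos x} {sin t *ᴿ (-ᴿ sin (-ᴿ x))} {0ᴿ *ᴿ (-ᴿ sin (-ᴿ x))}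
           (*ᴿ-cong {cos t} {1ᴿ} {cos (-ᴿ x)} {cos x} c (cos-neg x))
           (*ᴿ-cong {sin t} {0ᴿ} { -ᴿ sin (-ᴿ x)} { -ᴿ sin (-ᴿ x)} s ≈-refl) ⟩
    1ᴿ *ᴿ cos x +ᴿ 0ᴿ *ᴿ (-ᴿ sin (-ᴿ x))
      ≈⟨ pointwise (λ n → solve 2 (λ a b → con 1ℚ :* a :+ con 0ℚ :* b := a) refl (seq (cos x) n) (seq (-ᴿ sin (-ᴿ x)) n)) ⟩
    cos x ∎
    where
    open SetoidReasoning ℝ-setoid
    open +-*-Solver

  sin-reflect : ∀ {t x y} → Direction t 1ℚ 0ℚ → y ≈ t +ᴿ (-ᴿ x) → sin y ≈ -ᴿ sin x
  sin-reflect {t} {x} {y} (c , s) y≈t-x = begin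
    sin y
      ≈⟨ sin-cong {y} {t +ᴿ (-ᴿ x)} y≈t-x ⟩
    sin (t +ᴿ (-ᴿ x))
      ≈⟨ sin-+ t (-ᴿ x) ⟩
    cos t *ᴿ sin (-ᴿ x) +ᴿ sin t *ᴿ cos (-ᴿ x)
      ≈⟨ +ᴿ-cong {cos t *ᴿ sin (-ᴿ x)} {1ᴿ *ᴿ (-ᴿ sin x)} {sin t *ᴿ cos (-ᴿ x)} {0ᴿ *ᴿ cos (-ᴿ x)}
           (*ᴿ-cong {cos t} {1ᴿ} {sin (-ᴿ x)} { -ᴿ sin x} c (sin-neg x))
           (*ᴿ-cong {sin t} {0ᴿ} {cos (-ᴿ x)} {cos (-ᴿ x)} s ≈-refl) ⟩
    1ᴿ *ᴿ (-ᴿ sin x) +ᴿ 0ᴿ *ᴿ cos (-ᴿ x)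
      ≈⟨ pointwise (λ n → solve 2 (λ a b → con 1ℚ :* a :+ con 0ℚ :* b := a) refl (seq (-ᴿ sin x) n) (seq (cos (-ᴿ x)) n)) ⟩
    -ᴿ sin x ∎
    where
    open SetoidReasoning ℝ-setoid
    open +-*-Solver

  module _ {π : ℝ} (isPi : IsPi π) (k : ℕ) (p q : ℚ) (2k-p≡q : ι k + ι k - p ≡ q) where

    2kπ-reflection : fromℚ q *ᴿ π ≈ fromℚ (ι k + ι k) *ᴿ π +ᴿ (-ᴿ (fromℚ p *ᴿ π))
    2kπ-reflection = pointwise λ n → trans (cong (_* seq π n) (sym 2k-p≡q))
      (solve 3 (λ t p y → (t :- p) :* y := t :* y :+ :- (p :* y)) refl (ι k + ι k) p (seq π n))
      where open +-*-Solver

    cos-2kπ- : cos (fromℚ q *ᴿ π) ≈ cos (fromℚ p *ᴿ π)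
    cos-2kπ- = cos-reflect {fromℚ (ι k + ι k) *ᴿ π} {fromℚ p *ᴿ π} {fromℚ q *ᴿ π}
      (direction-2kπ {π} isPi k refl) 2kπ-reflection

    sin-2kπ- : sin (fromℚ q *ᴿ π) ≈ -ᴿ sin (fromℚ p *ᴿ π)
    sin-2kπ- = sin-reflect {fromℚ (ι k + ι k) *ᴿ π} {fromℚ p *ᴿ π} {fromℚ q *ᴿ π}
      (direction-2kπ {π} isPi k refl) 2kπ-reflection

  -- Rational angles as integer equations

  open import Data.Integer.Base as ℤ using (ℤ; +_; -[1+_])

  -- Cross-multiplication is read off from unnormalised fractions, since normalised ones may have
  -- cancelled common factors.
  toℚᵘ-/+/ : ∀ a m b n → toℚᵘ (a / suc m + b / suc n) ᵘ.≃ ᵘ.mkℚᵘ a m ᵘ.+ ᵘ.mkℚᵘ b n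
  toℚᵘ-/+/ a m b n = ᵘₚ.≃-trans (toℚᵘ-homo-+ (a / suc m) (b / suc n))
    (ᵘₚ.+-cong (toℚᵘ-fromℚᵘ (ᵘ.mkℚᵘ a m)) (toℚᵘ-fromℚᵘ (ᵘ.mkℚᵘ b n)))

  /+/≡/⇒ : ∀ a m b n c k .{{_ : ℕ.NonZero m}} .{{_ : ℕ.NonZero n}} .{{_ : ℕ.NonZero k}} →
    a / m + b / n ≡ c / k → (a ℤ.* + n ℤ.+ b ℤ.* + m) ℤ.* + k ≡ c ℤ.* (+ (m ℕ.* n))
  /+/≡/⇒ a (suc m) b (suc n) c (suc k) eq = ᵘₚ.drop-*≡* (ᵘₚ.≃-trans (ᵘₚ.≃-sym (toℚᵘ-/+/ a m b n))
    (ᵘₚ.≃-trans (toℚᵘ-cong eq) (toℚᵘ-fromℚᵘ (ᵘ.mkℚᵘ c k))))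

  ⇒/+/≡/ : ∀ a m b n c k .{{_ : ℕ.NonZero m}} .{{_ : ℕ.NonZero n}} .{{_ : ℕ.NonZero k}} →
    (a ℤ.* + n ℤ.+ b ℤ.* + m) ℤ.* + k ≡ c ℤ.* (+ (m ℕ.* n)) → a / m + b / n ≡ c / k
  ⇒/+/≡/ a (suc m) b (suc n) c (suc k) eq = toℚᵘ-injective (ᵘₚ.≃-trans (toℚᵘ-/+/ a m b n)
    (ᵘₚ.≃-trans (ᵘ.*≡* eq) (ᵘₚ.≃-sym (toℚᵘ-fromℚᵘ (ᵘ.mkℚᵘ c k)))))

  unit : Sign → ℤ
  unit Sign.+ = + 1
  unit Sign.- = ℤ.- + 1

  -- 2πa/n = ±2π/3 + 2kπ, cleared of denominators.
  Third : ℕ → ℕ → Set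
  Third n a = ∃[ s ] ∃[ k ] (unit s ℤ.+ + 3 ℤ.* k) ℤ.* + n ≡ + 3 ℤ.* + a

  angleCoeff : Sign → ℤ → ℚ
  angleCoeff s k = (+ 2 ℤ.* unit s) / 3 + (+ 2 ℤ.* k) / 1

  module _ (s : Sign) (k : ℤ) (n a : ℕ) .{{_ : ℕ.NonZero n}} where

    open ℤSolver.+-*-Solver

    private
      lhs≡ : (+ 2 ℤ.* unit s ℤ.* + 1 ℤ.+ + 2 ℤ.* k ℤ.* + 3) ℤ.* + n ≡ + 2 ℤ.* ((unit s ℤ.+ + 3 ℤ.* k) ℤ.* + n)
      lhs≡ = solve 3 (λ u k n → (con (+ 2) :* u :* con (+ 1) :+ con (+ 2) :* k :* con (+ 3)) :* n
        := con (+ 2) :* ((u :+ con (+ 3) :* k) :* n)) refl (unit s) k (+ n)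
      rhs≡ : + (2 ℕ.* a) ℤ.* + 3 ≡ + 2 ℤ.* (+ 3 ℤ.* + a)
      rhs≡ = trans (cong (ℤ._* + 3) (ℤₚ.pos-* 2 a))
        (solve 1 (λ a → con (+ 2) :* a :* con (+ 3) := con (+ 2) :* (con (+ 3) :* a)) refl (+ a))

    angleCoeff≡⇒ : angleCoeff s k ≡ + (2 ℕ.* a) / n → (unit s ℤ.+ + 3 ℤ.* k) ℤ.* + n ≡ + 3 ℤ.* + a
    angleCoeff≡⇒ eq = ℤₚ.*-cancelˡ-≡ (+ 2) _ _ (trans (sym lhs≡) (trans
      (/+/≡/⇒ (+ 2 ℤ.* unit s) 3 (+ 2 ℤ.* k) 1 (+ (2 ℕ.* a)) n eq) rhs≡))

    ⇒angleCoeff≡ : (unit s ℤ.+ + 3 ℤ.* k) ℤ.* + n ≡ + 3 ℤ.* + a → angleCoeff s k ≡ + (2 ℕ.* a) / n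
    ⇒angleCoeff≡ eq = ⇒/+/≡/ (+ 2 ℤ.* unit s) 3 (+ 2 ℤ.* k) 1 (+ (2 ℕ.* a)) n
      (trans lhs≡ (trans (cong (+ 2 ℤ.*_) eq) (sym rhs≡)))

  -- 2πb/n is m full turns minus 2πa/n, so the sign flips and k becomes m - k. The case m = 1 serves
  -- j itself, and m = c serves jc, because ic + jc = cn.
  Third-complement : ∀ {n a b} m → a ℕ.+ b ≡ m ℕ.* n → Third n a → Third n b
  Third-complement {n} {a} {b} m a+b≡mn (s , k , eq) = Sign.opposite s , + m ℤ.- k , (begin
    (unit (Sign.opposite s) ℤ.+ + 3 ℤ.* (+ m ℤ.- k)) ℤ.* + n
      ≡⟨ cong (λ u → (u ℤ.+ + 3 ℤ.* (+ m ℤ.- k)) ℤ.* + n) (unit-opposite s) ⟩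
    (ℤ.- unit s ℤ.+ + 3 ℤ.* (+ m ℤ.- k)) ℤ.* + n
      ≡⟨ solve 4 (λ u m k n → (:- u :+ con (+ 3) :* (m :- k)) :* n
           := con (+ 3) :* (m :* n) :- (u :+ con (+ 3) :* k) :* n) refl (unit s) (+ m) k (+ n) ⟩
    + 3 ℤ.* (+ m ℤ.* + n) ℤ.- (unit s ℤ.+ + 3 ℤ.* k) ℤ.* + n
      ≡⟨ cong₂ (λ x y → + 3 ℤ.* x ℤ.- y)
           (trans (sym (ℤₚ.pos-* m n)) (trans (cong +_ (sym a+b≡mn)) (ℤₚ.pos-+ a b))) eq ⟩
    + 3 ℤ.* (+ a ℤ.+ + b) ℤ.- + 3 ℤ.* + a
      ≡⟨ solve 2 (λ a b → con (+ 3) :* (a :+ b) :- con (+ 3) :* a := con (+ 3) :* b) refl (+ a) (+ b) ⟩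
    + 3 ℤ.* + b ∎)
    where
    open ≡-Reasoning
    open ℤSolver.+-*-Solver
    unit-opposite : ∀ s → unit (Sign.opposite s) ≡ ℤ.- unit s
    unit-opposite Sign.+ = refl
    unit-opposite Sign.- = refl

  3∤unit+3* : ∀ s k → ¬ (+ 3 ℤᵈ.∣ unit s ℤ.+ + 3 ℤ.* k)
  3∤unit+3* s k 3∣ = 3∤unit s (ℤᵈ.∣⇒∣ᵤ (ℤᵈ.∣m+n∣m⇒∣n {m = + 3 ℤ.* k}
    (subst (+ 3 ℤᵈ.∣_) (ℤₚ.+-comm (unit s) (+ 3 ℤ.* k)) 3∣) (ℤᵈ.∣m⇒∣m*n k ℤᵈ.∣-refl)))
    where
    3∤unit : ∀ s → ¬ (3 ℕᵈ.∣ ℤ.∣ unit s ∣)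
    3∤unit Sign.+ = ℕᵈ.>⇒∤ (ℕ.s≤s (ℕ.s≤s ℕ.z≤n))
    3∤unit Sign.- = ℕᵈ.>⇒∤ (ℕ.s≤s (ℕ.s≤s ℕ.z≤n))

  module _ {n j : ℕ} .{{_ : ℕ.NonZero n}} where

    Third⇒3j : j ℕ.< n → Third n j → 3 ℕ.* j ≡ n ⊎ 3 ℕ.* j ≡ 2 ℕ.* n
    Third⇒3j j<n (s , k , eq) = go (unit s ℤ.+ + 3 ℤ.* k) (3∤unit+3* s k) (trans eq (sym (ℤₚ.pos-* 3 j)))
      where
      -- In un = 3j the bounds 0 ≤ j < n force 0 ≤ u < 3. The value u = 0, that is j = 0, is
      -- excluded by divisibility and not by size.
      go : ∀ u → ¬ (+ 3 ℤᵈ.∣ u) → u ℤ.* + n ≡ + (3 ℕ.* j) → 3 ℕ.* j ≡ n ⊎ 3 ℕ.* j ≡ 2 ℕ.* n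
      go (+ 0) 3∤u _ = contradiction (ℤᵈ.divides (+ 0) refl) 3∤u
      go (+ 1) _ e = inj₁ (trans (sym (ℤₚ.+-injective (trans (ℤₚ.pos-* 1 n) e))) (ℕₚ.*-identityˡ n))
      go (+ 2) _ e = inj₂ (sym (ℤₚ.+-injective (trans (ℤₚ.pos-* 2 n) e)))
      go (+ suc (suc (suc v))) _ e = contradiction
        (ℕₚ.≤-trans (ℕₚ.*-monoˡ-≤ n (ℕₚ.m≤m+n 3 v)) (ℕₚ.≤-reflexive (ℤₚ.+-injective (trans (ℤₚ.pos-* (3 ℕ.+ v) n) e))))
        (ℕₚ.<⇒≱ (ℕₚ.*-monoʳ-< 3 j<n))
      go -[1+ v ] _ e = contradiction (subst (ℤ._≤ ℤ.-1ℤ) e (neg≤ n)) λ ()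
        where
        neg≤ : ∀ m .{{_ : ℕ.NonZero m}} → -[1+ v ] ℤ.* + m ℤ.≤ ℤ.-1ℤ
        neg≤ (suc m) = ℤ.-≤- ℕ.z≤n

    -- From un = 3j and wn = 3jc follows w = uc, while w is prime to 3.
    Third⇒3∤c : ∀ {c} → Third n j → Third n (j ℕ.* c) → ¬ (3 ℕᵈ.∣ c)
    Third⇒3∤c {c} (s , k , eq) (s′ , k′ , eq′) 3∣c = 3∤unit+3* s′ k′
      (subst (+ 3 ℤᵈ.∣_) (sym w≡uc) (ℤᵈ.∣n⇒∣m*n u (ℤᵈ.∣ᵤ⇒∣ 3∣c)))
      where
      open ≡-Reasoning
      open ℤSolver.+-*-Solver
      u = unit s ℤ.+ + 3 ℤ.* k
      w = unit s′ ℤ.+ + 3 ℤ.* k′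
      w≡uc : w ≡ u ℤ.* + c
      w≡uc = ℤₚ.*-cancelʳ-≡ w (u ℤ.* + c) (+ n) (begin
        w ℤ.* + n               ≡⟨ eq′ ⟩
        + 3 ℤ.* + (j ℕ.* c)     ≡⟨ cong (+ 3 ℤ.*_) (ℤₚ.pos-* j c) ⟩
        + 3 ℤ.* (+ j ℤ.* + c)   ≡⟨ ℤₚ.*-assoc (+ 3) (+ j) (+ c) ⟨
        + 3 ℤ.* + j ℤ.* + c     ≡⟨ cong (ℤ._* + c) eq ⟨
        u ℤ.* + n ℤ.* + c       ≡⟨ solve 3 (λ u n c → u :* n :* c := u :* c :* n) refl u (+ n) (+ c) ⟩
        u ℤ.* + c ℤ.* + n       ∎)

  module _ {n : ℕ} .{{_ : ℕ.NonZero n}} where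

    -- Division in ℕ truncates, so 3 ∣ n is what gives i = n / 3 its intended meaning; the theorem
    -- asserts it alongside.
    multiple-of-third : ∀ {i} → 3 ℕᵈ.∣ n → i ≡ n /ℕ 3 ⊎ i ≡ 2 ℕ.* n /ℕ 3 → 3 ℕ.* i ≡ n ⊎ 3 ℕ.* i ≡ 2 ℕ.* n
    multiple-of-third 3∣n (inj₁ refl) = inj₁ (m*[n/m]≡n 3∣n)
    multiple-of-third 3∣n (inj₂ refl) = inj₂ (m*[n/m]≡n (ℕᵈ.∣n⇒∣m*n 2 3∣n))

    multiple-of-third⁻¹ : ∀ {i} → 3 ℕ.* i ≡ n ⊎ 3 ℕ.* i ≡ 2 ℕ.* n → i ≡ n /ℕ 3 ⊎ i ≡ 2 ℕ.* n /ℕ 3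
    multiple-of-third⁻¹ {i} (inj₁ eq) = inj₁ (trans (sym (m*n/n≡m i 3)) (cong (_/ℕ 3) (trans (ℕₚ.*-comm i 3) eq)))
    multiple-of-third⁻¹ {i} (inj₂ eq) = inj₂ (trans (sym (m*n/n≡m i 3)) (cong (_/ℕ 3) (trans (ℕₚ.*-comm i 3) eq)))

    multiple-of-third⇒3∣n : ∀ {i} → 3 ℕ.* i ≡ n ⊎ 3 ℕ.* i ≡ 2 ℕ.* n → 3 ℕᵈ.∣ n
    multiple-of-third⇒3∣n {i} (inj₁ eq) = ℕᵈ.divides i (trans (sym eq) (ℕₚ.*-comm 3 i))
    multiple-of-third⇒3∣n {i} (inj₂ eq) = coprime-divisor (toWitness {a? = coprime? 3 2} _)
      (ℕᵈ.divides i (trans (sym eq) (ℕₚ.*-comm 3 i)))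

    equal-or-complementary : ∀ {i j} → 3 ℕ.* i ≡ n ⊎ 3 ℕ.* i ≡ 2 ℕ.* n → 3 ℕ.* j ≡ n ⊎ 3 ℕ.* j ≡ 2 ℕ.* n →
      i ≡ j ⊎ i ℕ.+ j ≡ n
    equal-or-complementary {i} {j} (inj₁ p) (inj₁ q) = inj₁ (ℕₚ.*-cancelˡ-≡ i j 3 (trans p (sym q)))
    equal-or-complementary {i} {j} (inj₂ p) (inj₂ q) = inj₁ (ℕₚ.*-cancelˡ-≡ i j 3 (trans p (sym q)))
    equal-or-complementary {i} {j} (inj₁ p) (inj₂ q) = inj₂ (ℕₚ.*-cancelˡ-≡ (i ℕ.+ j) n 3
      (trans (ℕₚ.*-distribˡ-+ 3 i j) (cong₂ ℕ._+_ p q)))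
    equal-or-complementary {i} {j} (inj₂ p) (inj₁ q) = inj₂ (ℕₚ.*-cancelˡ-≡ (i ℕ.+ j) n 3
      (trans (ℕₚ.*-distribˡ-+ 3 i j) (trans (cong₂ ℕ._+_ p q) (ℕₚ.+-comm (2 ℕ.* n) n))))

  -- Agrees by definition with the function `angle` local to `Type2`.
  angle : ℝ → Sign → ℤ → ℝ
  angle π s k = (± s) (fromℚ (+ 2 / 3) *ᴿ π) +ᴿ fromℚ ((+ 2 ℤ.* k) / 1) *ᴿ π

  angle≈ : ∀ π s k → angle π s k ≈ fromℚ (angleCoeff s k) *ᴿ π
  angle≈ π s k = pointwise λ n → trans (cong (_+ q * seq π n) (±-value s n))
    (sym (*-distribʳ-+ (seq π n) ((+ 2 ℤ.* unit s) / 3) q))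
    where
    q = (+ 2 ℤ.* k) / 1
    ±-value : ∀ s n → seq ((± s) (fromℚ (+ 2 / 3) *ᴿ π)) n ≡ (+ 2 ℤ.* unit s) / 3 * seq π n
    ±-value Sign.+ n = refl
    ±-value Sign.- n = neg-distribˡ-* (+ 2 / 3) (seq π n)

  -- Conjugate character sums

  module _ {A : Set} (f g : A → ℂ) (f≃ḡ : ∀ x → re (f x) ≃ᴿ re (g x) × im (f x) ≃ᴿ -ᴿ im (g x)) where

    Σ-conjugate-re : ∀ l → re (foldr _+ᶜ_ 0ᶜ (map f l)) ≃ᴿ re (foldr _+ᶜ_ 0ᶜ (map g l))
    Σ-conjugate-re []      = ≈⇒≃ {0ᴿ} {0ᴿ} ≈-refl
    Σ-conjugate-re (x ∷ l) = ≈⇒≃ (+ᴿ-cong {re (f x)} {re (g x)}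
      {re (foldr _+ᶜ_ 0ᶜ (map f l))} {re (foldr _+ᶜ_ 0ᶜ (map g l))} ⟪ proj₁ (f≃ḡ x) ⟫ ⟪ Σ-conjugate-re l ⟫)

    Σ-conjugate-im : ∀ l → im (foldr _+ᶜ_ 0ᶜ (map f l)) ≃ᴿ -ᴿ im (foldr _+ᶜ_ 0ᶜ (map g l))
    Σ-conjugate-im []      = ≈⇒≃ {0ᴿ} { -ᴿ 0ᴿ} (pointwise λ _ → refl)
    Σ-conjugate-im (x ∷ l) = go (im (f x)) (im (g x)) (im (foldr _+ᶜ_ 0ᶜ (map f l))) (im (foldr _+ᶜ_ 0ᶜ (map g l)))
      ⟪ proj₂ (f≃ḡ x) ⟫ ⟪ Σ-conjugate-im l ⟫
      where
      go : ∀ a b c d → a ≈ -ᴿ b → c ≈ -ᴿ d → a +ᴿ c ≃ᴿ -ᴿ (b +ᴿ d)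
      go a b c d p q = ≈⇒≃ (≈-trans {a +ᴿ c} {(-ᴿ b) +ᴿ (-ᴿ d)} { -ᴿ (b +ᴿ d)} (+ᴿ-cong {a} { -ᴿ b} {c} { -ᴿ d} p q)
        (pointwise λ n → sym (neg-distrib-+ (seq b n) (seq d n))))

    -- Conjugation commutes with sums, and -1 is its own conjugate.
    conjugate-of-minus-one : ∀ l → foldr _+ᶜ_ 0ᶜ (map g l) ≃ᶜ -1ᶜ → foldr _+ᶜ_ 0ᶜ (map f l) ≃ᶜ -1ᶜ
    conjugate-of-minus-one l (re≃ , im≃) =
      go (re F) (re G) ⟪ Σ-conjugate-re l ⟫ ⟪ re≃ ⟫ , go′ (im F) (im G) ⟪ Σ-conjugate-im l ⟫ ⟪ im≃ ⟫
      where
      F = foldr _+ᶜ_ 0ᶜ (map f l)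
      G = foldr _+ᶜ_ 0ᶜ (map g l)
      go : ∀ a b → a ≈ b → b ≈ -ᴿ 1ᴿ → a ≃ᴿ -ᴿ 1ᴿ
      go a b p q = ≈⇒≃ (≈-trans {a} {b} { -ᴿ 1ᴿ} p q)
      go′ : ∀ a b → a ≈ -ᴿ b → b ≈ 0ᴿ → a ≃ᴿ 0ᴿ
      go′ a b p q = ≈⇒≃ (≈-trans {a} { -ᴿ b} {0ᴿ} p
        (≈-trans { -ᴿ b} { -ᴿ 0ᴿ} {0ᴿ} (-ᴿ-cong {b} {0ᴿ} q) (pointwise λ _ → refl)))

  module _ {π : ℝ} (isPi : IsPi π) {n : ℕ} .{{n≢0 : ℕ.NonZero n}} where

    -- The numerator is kept as m with m = 2a because `Type2` brackets it as (2j)c, whereas `Third`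
    -- concerns a = jc.
    angle⇒Third : ∀ {m} a s k → m ≡ 2 ℕ.* a → fromℚ (+ m / n) *ᴿ π ≃ᴿ angle π s k → Third n a
    angle⇒Third a s k refl h = s , k , angleCoeff≡⇒ s k n a (sym (coeff≡ (+ (2 ℕ.* a) / n) h))
      where
      coeff≡ : ∀ q → fromℚ q *ᴿ π ≃ᴿ angle π s k → q ≡ angleCoeff s k
      coeff≡ q h = fromℚ*π-injective {π} isPi {q} {angleCoeff s k}
        (≈-trans {fromℚ q *ᴿ π} {angle π s k} {fromℚ (angleCoeff s k) *ᴿ π} ⟪ h ⟫ (angle≈ π s k))

    Third⇒angle : ∀ {m} a s k → m ≡ 2 ℕ.* a → (unit s ℤ.+ + 3 ℤ.* k) ℤ.* + n ≡ + 3 ℤ.* + a →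
      fromℚ (+ m / n) *ᴿ π ≃ᴿ angle π s k
    Third⇒angle a s k refl eq = go (+ (2 ℕ.* a) / n) (sym (⇒angleCoeff≡ s k n a eq))
      where
      go : ∀ q → q ≡ angleCoeff s k → fromℚ q *ᴿ π ≃ᴿ angle π s k
      go q refl = ≈⇒≃ (≈-sym {angle π s k} {fromℚ (angleCoeff s k) *ᴿ π} (angle≈ π s k))

    module _ {i j : Fin n} (i+j≡n : toℕ i ℕ.+ toℕ j ≡ n) where

      private
        coeff : Fin n → Fin n → ℚ
        coeff j x = + (2 ℕ.* toℕ x ℕ.* toℕ j) / n

        coeff-complement : ∀ x → ι (toℕ x) + ι (toℕ x) - coeff i x ≡ coeff j x
        coeff-complement x = trans (cong (_- coeff i x) (trans double (sym sum≡)))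
          (R.solve 2 (λ a b → a R.:+ b R.:- a R.:= b) refl (coeff i x) (coeff j x))
          where
          module R = +-*-Solver
          open ≡-Reasoning
          open ℤSolver.+-*-Solver
          a = 2 ℕ.* toℕ x ℕ.* toℕ i
          b = 2 ℕ.* toℕ x ℕ.* toℕ j
          double : ι (toℕ x) + ι (toℕ x) ≡ + (2 ℕ.* toℕ x) / 1
          double = trans (sym (ι-+ (toℕ x) (toℕ x)))
            (cong (λ m → ι (toℕ x ℕ.+ m)) (sym (ℕₚ.+-identityʳ (toℕ x))))
          a+b≡ : a ℕ.+ b ≡ 2 ℕ.* toℕ x ℕ.* n
          a+b≡ = trans (sym (ℕₚ.*-distribˡ-+ (2 ℕ.* toℕ x) (toℕ i) (toℕ j))) (cong (2 ℕ.* toℕ x ℕ.*_) i+j≡n)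
          sum≡ : coeff i x + coeff j x ≡ + (2 ℕ.* toℕ x) / 1
          sum≡ = ⇒/+/≡/ (+ a) n (+ b) n (+ (2 ℕ.* toℕ x)) 1 (begin
            (+ a ℤ.* + n ℤ.+ + b ℤ.* + n) ℤ.* + 1
              ≡⟨ solve 3 (λ a b n → (a :* n :+ b :* n) :* con (+ 1) := (a :+ b) :* n) refl (+ a) (+ b) (+ n) ⟩
            (+ a ℤ.+ + b) ℤ.* + n
              ≡⟨ cong (ℤ._* + n) (trans (sym (ℤₚ.pos-+ a b)) (trans (cong +_ a+b≡) (ℤₚ.pos-* (2 ℕ.* toℕ x) n))) ⟩
            + (2 ℕ.* toℕ x) ℤ.* + n ℤ.* + n
              ≡⟨ ℤₚ.*-assoc (+ (2 ℕ.* toℕ x)) (+ n) (+ n) ⟩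
            + (2 ℕ.* toℕ x) ℤ.* (+ n ℤ.* + n)
              ≡⟨ cong (+ (2 ℕ.* toℕ x) ℤ.*_) (ℤₚ.pos-* n n) ⟨
            + (2 ℕ.* toℕ x) ℤ.* + (n ℕ.* n) ∎)

      χ-conj-re : ∀ x → re (χ π j x) ≃ᴿ re (χ π i x)
      χ-conj-re x = ≈⇒≃ (cos-2kπ- {π} isPi (toℕ x) (coeff i x) (coeff j x) (coeff-complement x))

      χ-conj-im : ∀ x → im (χ π j x) ≃ᴿ -ᴿ im (χ π i x)
      χ-conj-im x = ≈⇒≃ (sin-2kπ- {π} isPi (toℕ x) (coeff i x) (coeff j x) (coeff-complement x))

      𝒥-complement : ∀ S → 𝒥 π S i → 𝒥 π S j
      𝒥-complement S = conjugate-of-minus-one (χ π {n} {{n≢0}} j) (χ π {n} {{n≢0}} i) (λ x → χ-conj-re x , χ-conj-im x) (filter (_∈? S) (allFin n))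

  ⟅⟆-cong : ∀ a a′ b b′ → a ≃ᴿ a′ → b ≃ᴿ b′ → ⟅ a , b ⟆ ≐ ⟅ a′ , b′ ⟆
  ⟅⟆-cong a a′ b b′ p q =
    (λ { {x} (inj₁ h) → inj₁ (≈⇒≃ (≈-trans {x} {a} {a′} ⟪ h ⟫ ⟪ p ⟫))
       ; {x} (inj₂ h) → inj₂ (≈⇒≃ (≈-trans {x} {b} {b′} ⟪ h ⟫ ⟪ q ⟫)) }) ,
    (λ { {x} (inj₁ h) → inj₁ (≈⇒≃ (≈-trans {x} {a′} {a} ⟪ h ⟫ (≈-sym {a} {a′} ⟪ p ⟫)))
       ; {x} (inj₂ h) → inj₂ (≈⇒≃ (≈-trans {x} {b′} {b} ⟪ h ⟫ (≈-sym {b} {b′} ⟪ q ⟫))) })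

  -- Type 2 in terms of integer equations

  module _ {π : ℝ} (isPi : IsPi π) {n : ℕ} .{{n≢0 : ℕ.NonZero n}} {c : ℕ} where

    -- The equality of sets may match the angles in either order. This is harmless, because both
    -- elements on the right have the shape required by `Third`, with their own sign and k.
    Type2⇒Third : ∀ {j} → Type2 π n c j → Third n (toℕ j) × Third n (toℕ j ℕ.* c)
    Type2⇒Third {j} (_ , _ , s₁ , s₂ , k₁ , k₂ , ⊆ , _) =
      third (toℕ j) refl (⊆ {x} (inj₁ (≈⇒≃ {x} {x} ≈-refl))) ,
      third (toℕ j ℕ.* c) (ℕₚ.*-assoc 2 (toℕ j) c) (⊆ {y} (inj₂ (≈⇒≃ {y} {y} ≈-refl)))
      where
      x y : ℝ
      x = fromℚ (+ (2 ℕ.* toℕ j) / n) *ᴿ π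
      y = fromℚ (+ (2 ℕ.* toℕ j ℕ.* c) / n) *ᴿ π
      third : ∀ {m} a → m ≡ 2 ℕ.* a → ⟅ angle π s₁ k₁ , angle π s₂ k₂ ⟆ (fromℚ (+ m / n) *ᴿ π) → Third n a
      third a m≡2a (inj₁ h) = angle⇒Third {π} isPi a s₁ k₁ m≡2a h
      third a m≡2a (inj₂ h) = angle⇒Third {π} isPi a s₂ k₂ m≡2a h

    Third⇒Type2 : ∀ {j} → 2 ℕᵈ.∣ toℕ j → 𝒥 π (connectionSet n c) j →
      Third n (toℕ j) → Third n (toℕ j ℕ.* c) → Type2 π n c j
    Third⇒Type2 {j} 2∣j j∈𝒥 (s₁ , k₁ , eq₁) (s₂ , k₂ , eq₂) = 2∣j , j∈𝒥 , s₁ , s₂ , k₁ , k₂ ,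
      ⟅⟆-cong (fromℚ (+ (2 ℕ.* toℕ j) / n) *ᴿ π) (angle π s₁ k₁)
        (fromℚ (+ (2 ℕ.* toℕ j ℕ.* c) / n) *ᴿ π) (angle π s₂ k₂)
        (Third⇒angle {π} isPi (toℕ j) s₁ k₁ refl eq₁)
        (Third⇒angle {π} isPi (toℕ j ℕ.* c) s₂ k₂ (ℕₚ.*-assoc 2 (toℕ j) c) eq₂)

    Type2-complement : ∀ {i j} → 2 ℕᵈ.∣ n → toℕ i ℕ.+ toℕ j ≡ n → Type2 π n c i → Type2 π n c j
    Type2-complement {i} {j} 2∣n i+j≡n type2@(2∣i , i∈𝒥 , _) = Third⇒Type2 {j}
      (ℕᵈ.∣m+n∣m⇒∣n (subst (2 ℕᵈ.∣_) (sym i+j≡n) 2∣n) 2∣i)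
      (𝒥-complement {π} isPi {n} {{n≢0}} {i} {j} i+j≡n (connectionSet n c) i∈𝒥)
      (Third-complement {n} {toℕ i} {toℕ j} 1 (trans i+j≡n (sym (ℕₚ.*-identityˡ n))) (proj₁ thirds))
      (Third-complement {n} {toℕ i ℕ.* c} {toℕ j ℕ.* c} c (trans (sym (ℕₚ.*-distribʳ-+ c (toℕ i) (toℕ j)))
        (trans (cong (ℕ._* c) i+j≡n) (ℕₚ.*-comm n c))) (proj₂ thirds))
      where thirds = Type2⇒Third {i} type2

open import Data.Nat using (NonZero; _*_; _/_; _≤_; _<_)
open import Data.Nat.Divisibility using (_∣_)

lemma4p5 : (π : ℝ) → IsPi π → (n : ℕ) .{{_ : NonZero n}} → 6 ≤ n → 2 ∣ n →
  (c : ℕ) → 1 < c → c < n / 2 →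
  ClosedDistanceMagic (Cay (connectionSet n c)) →
  ∃ (Type2 π n c) →
  (3 ∣ n × (∀ j → Type2 π n c j ⇔ (toℕ j ≡ n / 3 ⊎ toℕ j ≡ 2 * n / 3)))
  × ¬ (3 ∣ c)
lemma4p5 π isPi n {{n≢0}} _ 2∣n c _ _ _ (i , type2) =
  (3∣n , λ j → mk⇔ (λ t → multiple-of-third⁻¹ {n} {toℕ j} (position j t)) (converse j)) ,
  Third⇒3∤c {n} {toℕ i} {c} (proj₁ thirds) (proj₂ thirds)
  where
  position : ∀ j → Type2 π n {{n≢0}} c j → 3 * toℕ j ≡ n ⊎ 3 * toℕ j ≡ 2 * n
  position j t = Third⇒3j {n} {toℕ j} (toℕ<n j) (proj₁ (Type2⇒Third {π} isPi {n} {{n≢0}} {c} {j} t))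
  thirds : Third n (toℕ i) × Third n (toℕ i * c)
  thirds = Type2⇒Third {π} isPi {n} {{n≢0}} {c} {i} type2
  3∣n : 3 ∣ n
  3∣n = multiple-of-third⇒3∣n {n} {toℕ i} (position i type2)
  converse : ∀ j → toℕ j ≡ n / 3 ⊎ toℕ j ≡ 2 * n / 3 → Type2 π n {{n≢0}} c j
  converse j j≡ = [ (λ i≡j → subst (Type2 π n {{n≢0}} c) (toℕ-injective i≡j) type2)
                  , (λ i+j≡n → Type2-complement {π} isPi {n} {{n≢0}} {c} {i} {j} 2∣n i+j≡n type2) ]′
    (equal-or-complementary {n} {toℕ i} {toℕ j} (position i type2) (multiple-of-third {n} {toℕ j} 3∣n j≡))
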